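{- Every (finite, simple, connected) fractionally Hamiltonian graph is resistance positive (RP).
   Context: All graphs are finite, simple and connected. For a nonempty proper set $S\subsetneq V(G)$, let $\partial(S):=\{uv\in E(G): |\{u,v\}\cap S|=1\}$. For an edge weighting $f:E(G)\to\mathbb R$ and $F\subseteq E(G)$, write $f(F):=\sum_{e\in F}f(e)$. A fractional Hamiltonian cycle of $G$ is an edge weighting $f:E(G)\to[0,1]$ such that $f(E(G))=|V(G)|$ and $f(\partial(S))\ge 2$ for every nonempty proper set $S\subsetneq V(G)$. A graph is fractionally Hamiltonian if it has a fractional Hamiltonian cycle. Resistance curvature: let $G=(V,E)$ be a finite simple connected graph, $\mathcal T(G)$ its set of spanning trees, and $c=(c_e)_{e\in E}$ positive edge weights. The relative resistance of an edge $e$ is $$r_e(c):=\frac{\sum_{T\in\mathcal T(G),\, e\in T}\prod_{h\in T}c_h}{\sum_{T\in\mathcal T(G)}\prod_{h\in T}c_h}$$ (equivalently $c_e$ times the effective resistance between the ends of $e$), and the resistance curvature of a vertex $v$ is $p_v(c):=1-\frac12\sum_{e\ni v}r_e(c)$. $G$ is resistance positive (RP) if there exist positive edge weights $c$ with $p_v(c)>0$ for every $v\in V$. -}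

module Defs where

open import Level using (0ℓ)
open import Algebra.Bundles.Raw using (RawMonoid)
import Algebra.Definitions.RawMonoid as MonoidSum
open import Data.Bool.Base using (if_then_else_; _∨_; _xor_)
open import Data.Empty using (⊥-elim)
open import Data.Fin.Base as Fin using (Fin; zero; suc; toℕ; fromℕ<)
import Data.Fin.Properties as Fin
open import Data.Fin.Subset using (Subset; inside; outside; _∈_; _⊂_; Nonempty; ⊤)
open import Data.Fin.Subset.Properties using (_∈?_)
open import Data.Integer.Base using (+_)
open import Data.List.Base as List using (List; []; _∷_; _∷ʳ_; _++_; length; filter; foldr; map)
open import Data.List.Membership.Propositional.Properties using (∈-lookup)
import Data.List.Relation.Unary.All as All
open import Data.List.Relation.Unary.AllPairs using (_∷_)
open import Data.List.Relation.Unary.Linked using (Linked; linked?)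
open import Data.List.Relation.Unary.Unique.Propositional using (Unique)
import Data.List.Relation.Unary.Unique.DecPropositional as DecUnique
open import Data.Nat.Base as ℕ using (ℕ; zero; suc; z≤n; s≤s)
import Data.Nat.Properties as ℕ
open import Data.Product.Base using (Σ-syntax; ∃; ∃-syntax; _×_; _,_; proj₁; proj₂)
open import Data.Product.Properties using (≡-dec)
open import Data.Rational.Base as ℚ using (ℚ; 0ℚ; 1ℚ; ½)
import Data.Rational.Properties as ℚ
open import Data.Rational.Solver using (module +-*-Solver)
open import Data.Sum.Base using (_⊎_; inj₁; inj₂)
open import Data.Vec.Base using (lookup; tabulate; []; _∷_)
open import Function.Definitions using (Injective)
open import Relation.Binary.Construct.Closure.ReflexiveTransitive using (Star; ε; _◅_; _◅◅_)
open import Relation.Binary.PropositionalEquality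
open import Relation.Nullary using (Dec; yes; no; does; ¬_)
open import Relation.Nullary.Decidable using (_×-dec_; _⊎-dec_; map′; ¬?)
open import Relation.Unary using (Decidable)

-- Real numbers, as Cauchy sequences of rationals.
--
-- The Cauchy property carries its modulus (through Σ), so no choice
-- principle is needed; two sequences denote the same real when _≃_.

Cauchy : (ℕ → ℚ) → Set
Cauchy x = ∀ δ → 0ℚ ℚ.< δ →
  ∃[ N ] ∀ {i j} → N ℕ.≤ i → N ℕ.≤ j → ℚ.∣ x i ℚ.- x j ∣ ℚ.< δ

record ℝ : Set where
  constructor mkℝ
  field
    seq    : ℕ → ℚ
    cauchy : Cauchy seq

open ℝ public

p-q+q : ∀ p q → (p ℚ.- q) ℚ.+ q ≡ p
p-q+q = solve 2 (λ p q → (p :- q) :+ q := p) refl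
  where open +-*-Solver

-‿flip : ∀ p q → p ℚ.- q ≡ ℚ.- (q ℚ.- p)
-‿flip = solve 2 (λ p q → p :- q := :- (q :- p)) refl
  where open +-*-Solver

-‿neg : ∀ p q → ℚ.- (p ℚ.- q) ≡ (ℚ.- p) ℚ.- (ℚ.- q)
-‿neg = solve 2 (λ p q → :- (p :- q) := (:- p) :- (:- q)) refl
  where open +-*-Solver

-‿interchange : ∀ p q r s → (p ℚ.+ q) ℚ.- (r ℚ.+ s) ≡ (p ℚ.- r) ℚ.+ (q ℚ.- s)
-‿interchange = solve 4 (λ p q r s → (p :+ q) :- (r :+ s) := (p :- r) :+ (q :- s)) refl
  where open +-*-Solver

telescope : ∀ p q r → p ℚ.- r ≡ (p ℚ.- q) ℚ.+ (q ℚ.- r)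
telescope = solve 3 (λ p q r → p :- r := (p :- q) :+ (q :- r)) refl
  where open +-*-Solver

*-distribˡ-‿ : ∀ p q r → p ℚ.* q ℚ.- p ℚ.* r ≡ p ℚ.* (q ℚ.- r)
*-distribˡ-‿ = solve 3 (λ p q r → p :* q :- p :* r := p :* (q :- r)) refl
  where open +-*-Solver

*-difference : ∀ p q r s →
  p ℚ.* q ℚ.- r ℚ.* s ≡ p ℚ.* (q ℚ.- s) ℚ.+ s ℚ.* (p ℚ.- r)
*-difference p q r s = begin
  p ℚ.* q ℚ.- r ℚ.* s
    ≡⟨ telescope (p ℚ.* q) (p ℚ.* s) (r ℚ.* s) ⟩
  (p ℚ.* q ℚ.- p ℚ.* s) ℚ.+ (p ℚ.* s ℚ.- r ℚ.* s)
    ≡⟨ cong₂ (λ x y → (p ℚ.* q ℚ.- p ℚ.* s) ℚ.+ (x ℚ.- y)) (ℚ.*-comm p s) (ℚ.*-comm r s) ⟩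
  (p ℚ.* q ℚ.- p ℚ.* s) ℚ.+ (s ℚ.* p ℚ.- s ℚ.* r)
    ≡⟨ cong₂ ℚ._+_ (*-distribˡ-‿ p q s) (*-distribˡ-‿ s p r) ⟩
  p ℚ.* (q ℚ.- s) ℚ.+ s ℚ.* (p ℚ.- r) ∎
  where open ≡-Reasoning

half+half : ∀ q → ½ ℚ.* q ℚ.+ ½ ℚ.* q ≡ q
half+half q = trans (sym (ℚ.*-distribʳ-+ q ½ ½)) (ℚ.*-identityˡ q)

pos* : ∀ {p q} → 0ℚ ℚ.< p → 0ℚ ℚ.< q → 0ℚ ℚ.< p ℚ.* q
pos* {p} {q} 0<p 0<q = ℚ.positive⁻¹ _
  {{ℚ.pos*pos⇒pos p {{ℚ.positive 0<p}} q {{ℚ.positive 0<q}}}}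

0<½ : 0ℚ ℚ.< ½
0<½ = ℚ.positive⁻¹ ½

0<1 : 0ℚ ℚ.< 1ℚ
0<1 = ℚ.positive⁻¹ 1ℚ

shrink : ∀ B q → 0ℚ ℚ.< B → 0ℚ ℚ.< q → ∃[ δ ] 0ℚ ℚ.< δ × B ℚ.* δ ≡ q
shrink B q 0<B 0<q = 1/B ℚ.* q , pos* 0<1/B 0<q , (begin
  B ℚ.* (1/B ℚ.* q)  ≡⟨ ℚ.*-assoc B 1/B q ⟨
  (B ℚ.* 1/B) ℚ.* q  ≡⟨ cong (ℚ._* q) (ℚ.*-inverseʳ B) ⟩
  1ℚ ℚ.* q           ≡⟨ ℚ.*-identityˡ q ⟩
  q                  ∎)
  where
  open ≡-Reasoning
  instance
    B-pos     = ℚ.positive 0<B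
    B-nonZero = ℚ.pos⇒nonZero B
  1/B = ℚ.1/ B
  0<1/B = ℚ.positive⁻¹ 1/B {{ℚ.1/pos⇒pos B}}

*-mono-≤-< : ∀ {a b p q} → a ℚ.≤ b → 0ℚ ℚ.< b → 0ℚ ℚ.≤ p → p ℚ.< q →
             a ℚ.* p ℚ.< b ℚ.* q
*-mono-≤-< {a} {b} {p} a≤b 0<b 0≤p p<q = ℚ.≤-<-trans
  (ℚ.*-monoʳ-≤-nonNeg p {{ℚ.nonNegative 0≤p}} a≤b)
  (ℚ.*-monoʳ-<-pos b {{ℚ.positive 0<b}} p<q)

bounded : ∀ (x : ℝ) → ∃[ N ] ∃[ B ] 0ℚ ℚ.< B × (∀ {i} → N ℕ.≤ i → ℚ.∣ seq x i ∣ ℚ.≤ B)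
bounded x with N , close ← cauchy x 1ℚ 0<1 =
  N , 1ℚ ℚ.+ ℚ.∣ xN ∣ , ℚ.+-mono-<-≤ 0<1 (ℚ.0≤∣p∣ xN) , λ {i} N≤i →
    let xi = seq x i in begin
    ℚ.∣ xi ∣                       ≡⟨ cong ℚ.∣_∣ (sym (p-q+q xi xN)) ⟩
    ℚ.∣ (xi ℚ.- xN) ℚ.+ xN ∣       ≤⟨ ℚ.∣p+q∣≤∣p∣+∣q∣ (xi ℚ.- xN) xN ⟩
    ℚ.∣ xi ℚ.- xN ∣ ℚ.+ ℚ.∣ xN ∣   ≤⟨ ℚ.+-monoˡ-≤ ℚ.∣ xN ∣ (ℚ.<⇒≤ (close N≤i ℕ.≤-refl)) ⟩
    1ℚ ℚ.+ ℚ.∣ xN ∣                ∎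
  where
  open ℚ.≤-Reasoning
  xN = seq x N

+-cauchy : ∀ x y → Cauchy (λ i → seq x i ℚ.+ seq y i)
+-cauchy x y δ 0<δ
  with M , xc ← cauchy x (½ ℚ.* δ) (pos* 0<½ 0<δ)
     | N , yc ← cauchy y (½ ℚ.* δ) (pos* 0<½ 0<δ) =
  M ℕ.⊔ N , λ {i} {j} p q → let a = seq x i; b = seq y i; c = seq x j; d = seq y j in begin-strict
    ℚ.∣ (a ℚ.+ b) ℚ.- (c ℚ.+ d) ∣
      ≡⟨ cong ℚ.∣_∣ (-‿interchange a b c d) ⟩
    ℚ.∣ (a ℚ.- c) ℚ.+ (b ℚ.- d) ∣
      ≤⟨ ℚ.∣p+q∣≤∣p∣+∣q∣ (a ℚ.- c) (b ℚ.- d) ⟩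
    ℚ.∣ a ℚ.- c ∣ ℚ.+ ℚ.∣ b ℚ.- d ∣
      <⟨ ℚ.+-mono-< (xc (ℕ.m⊔n≤o⇒m≤o M N p) (ℕ.m⊔n≤o⇒m≤o M N q))
                    (yc (ℕ.m⊔n≤o⇒n≤o M N p) (ℕ.m⊔n≤o⇒n≤o M N q)) ⟩
    ½ ℚ.* δ ℚ.+ ½ ℚ.* δ
      ≡⟨ half+half δ ⟩
    δ ∎
  where open ℚ.≤-Reasoning

neg-cauchy : ∀ x → Cauchy (λ i → ℚ.- seq x i)
neg-cauchy x δ 0<δ with N , xc ← cauchy x δ 0<δ =
  N , λ {i} {j} p q → let a = seq x i; b = seq x j in
    subst (ℚ._< δ)
      (trans (sym (ℚ.∣-p∣≡∣p∣ (a ℚ.- b)))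
             (cong ℚ.∣_∣ (-‿neg a b)))
      (xc p q)

*-close : ∀ {B C η} a b c d → 0ℚ ℚ.< B → 0ℚ ℚ.< C →
          ℚ.∣ a ∣ ℚ.≤ B → ℚ.∣ d ∣ ℚ.≤ C →
          ℚ.∣ a ℚ.- c ∣ ℚ.< η → ℚ.∣ b ℚ.- d ∣ ℚ.< η →
          ℚ.∣ a ℚ.* b ℚ.- c ℚ.* d ∣ ℚ.< (B ℚ.+ C) ℚ.* η
*-close {B} {C} {η} a b c d 0<B 0<C a≤B d≤C a-c< b-d< = begin-strict
  ℚ.∣ a ℚ.* b ℚ.- c ℚ.* d ∣
    ≡⟨ cong ℚ.∣_∣ (*-difference a b c d) ⟩
  ℚ.∣ a ℚ.* (b ℚ.- d) ℚ.+ d ℚ.* (a ℚ.- c) ∣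
    ≤⟨ ℚ.∣p+q∣≤∣p∣+∣q∣ (a ℚ.* (b ℚ.- d)) (d ℚ.* (a ℚ.- c)) ⟩
  ℚ.∣ a ℚ.* (b ℚ.- d) ∣ ℚ.+ ℚ.∣ d ℚ.* (a ℚ.- c) ∣
    ≡⟨ cong₂ ℚ._+_ (ℚ.∣p*q∣≡∣p∣*∣q∣ a (b ℚ.- d)) (ℚ.∣p*q∣≡∣p∣*∣q∣ d (a ℚ.- c)) ⟩
  ℚ.∣ a ∣ ℚ.* ℚ.∣ b ℚ.- d ∣ ℚ.+ ℚ.∣ d ∣ ℚ.* ℚ.∣ a ℚ.- c ∣
    <⟨ ℚ.+-mono-< (*-mono-≤-< a≤B 0<B (ℚ.0≤∣p∣ (b ℚ.- d)) b-d<)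
                  (*-mono-≤-< d≤C 0<C (ℚ.0≤∣p∣ (a ℚ.- c)) a-c<) ⟩
  B ℚ.* η ℚ.+ C ℚ.* η
    ≡⟨ ℚ.*-distribʳ-+ η B C ⟨
  (B ℚ.+ C) ℚ.* η ∎
  where open ℚ.≤-Reasoning

*-cauchy : ∀ x y → Cauchy (λ i → seq x i ℚ.* seq y i)
*-cauchy x y δ 0<δ =
  let K , B , 0<B , xB = bounded x
      L , C , 0<C , yC = bounded y
      η , 0<η , eq     = shrink (B ℚ.+ C) δ (ℚ.+-mono-< 0<B 0<C) 0<δ
      M , xc           = cauchy x η 0<η
      N , yc           = cauchy y η 0<η
  in combine K L M N B C η 0<B 0<C eq xB yC xc yc
  where
  combine : ∀ K L M N B C η → 0ℚ ℚ.< B → 0ℚ ℚ.< C → (B ℚ.+ C) ℚ.* η ≡ δ →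
    (∀ {i} → K ℕ.≤ i → ℚ.∣ seq x i ∣ ℚ.≤ B) →
    (∀ {i} → L ℕ.≤ i → ℚ.∣ seq y i ∣ ℚ.≤ C) →
    (∀ {i j} → M ℕ.≤ i → M ℕ.≤ j → ℚ.∣ seq x i ℚ.- seq x j ∣ ℚ.< η) →
    (∀ {i j} → N ℕ.≤ i → N ℕ.≤ j → ℚ.∣ seq y i ℚ.- seq y j ∣ ℚ.< η) →
    ∃[ O ] ∀ {i j} → O ℕ.≤ i → O ℕ.≤ j →
      ℚ.∣ seq x i ℚ.* seq y i ℚ.- seq x j ℚ.* seq y j ∣ ℚ.< δ
  combine K L M N B C η 0<B 0<C eq xB yC xc yc =
    (K ℕ.⊔ L) ℕ.⊔ (M ℕ.⊔ N) , λ {i} {j} p q →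
    let KL≤i = ℕ.m⊔n≤o⇒m≤o (K ℕ.⊔ L) (M ℕ.⊔ N) p
        KL≤j = ℕ.m⊔n≤o⇒m≤o (K ℕ.⊔ L) (M ℕ.⊔ N) q
        MN≤i = ℕ.m⊔n≤o⇒n≤o (K ℕ.⊔ L) (M ℕ.⊔ N) p
        MN≤j = ℕ.m⊔n≤o⇒n≤o (K ℕ.⊔ L) (M ℕ.⊔ N) q
    in subst (ℚ.∣ seq x i ℚ.* seq y i ℚ.- seq x j ℚ.* seq y j ∣ ℚ.<_) eq
      (*-close (seq x i) (seq y i) (seq x j) (seq y j) 0<B 0<C
        (xB (ℕ.m⊔n≤o⇒m≤o K L KL≤i)) (yC (ℕ.m⊔n≤o⇒n≤o K L KL≤j))
        (xc (ℕ.m⊔n≤o⇒m≤o M N MN≤i) (ℕ.m⊔n≤o⇒m≤o M N MN≤j))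
        (yc (ℕ.m⊔n≤o⇒n≤o M N MN≤i) (ℕ.m⊔n≤o⇒n≤o M N MN≤j)))

const-cauchy : ∀ (q : ℚ) → Cauchy (λ _ → q)
const-cauchy q δ 0<δ = 0 , λ _ _ → subst (ℚ._< δ) (cong ℚ.∣_∣ (sym (ℚ.+-inverseʳ q))) 0<δ

infix  4 _≃_ _≤_ _<_
infixl 6 _+_ _-_
infixl 7 _*_
infix  8 -_

_≃_ : ℝ → ℝ → Set
x ≃ y = ∀ δ → 0ℚ ℚ.< δ → ∃[ N ] ∀ {i} → N ℕ.≤ i → ℚ.∣ seq x i ℚ.- seq y i ∣ ℚ.< δ

_≤_ : ℝ → ℝ → Set
x ≤ y = ∀ δ → 0ℚ ℚ.< δ → ∃[ N ] ∀ {i} → N ℕ.≤ i → seq x i ℚ.≤ seq y i ℚ.+ δ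

_<_ : ℝ → ℝ → Set
x < y = ∃[ δ ] 0ℚ ℚ.< δ × ∃[ N ] ∀ {i} → N ℕ.≤ i → seq x i ℚ.+ δ ℚ.≤ seq y i

fromℚ : ℚ → ℝ
fromℚ q = mkℝ (λ _ → q) (const-cauchy q)

fromℕ : ℕ → ℝ
fromℕ n = fromℚ (+ n ℚ./ 1)

0ℝ 1ℝ : ℝ
0ℝ = fromℚ 0ℚ
1ℝ = fromℚ 1ℚ

_+_ _*_ : ℝ → ℝ → ℝ
x + y = mkℝ (λ i → seq x i ℚ.+ seq y i) (+-cauchy x y)
x * y = mkℝ (λ i → seq x i ℚ.* seq y i) (*-cauchy x y)

-_ : ℝ → ℝ
-_ x = mkℝ (λ i → ℚ.- seq x i) (neg-cauchy x)

_-_ : ℝ → ℝ → ℝ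
x - y = x + (- y)

-- The terms of a positive Cauchy sequence are eventually positive; the
-- value chosen at 0ℚ only affects finitely many terms of a reciprocal.
recipℚ : ℚ → ℚ
recipℚ q with q ℚ.≟ 0ℚ
... | yes _  = 0ℚ
... | no q≢0 = ℚ.1/_ q {{ℚ.≢-nonZero q≢0}}

recipℚ-inverse : ∀ q → 0ℚ ℚ.< q → q ℚ.* recipℚ q ≡ 1ℚ
recipℚ-inverse q 0<q with q ℚ.≟ 0ℚ
... | yes q≡0 = ⊥-elim (ℚ.<-irrefl (sym q≡0) 0<q)
... | no q≢0  = ℚ.*-inverseʳ q {{ℚ.≢-nonZero q≢0}}

recip-cauchy : ∀ x → 0ℝ < x → Cauchy (λ i → recipℚ (seq x i))
recip-cauchy x (b , 0<b , M , b≤x) δ 0<δ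
  with N , xc ← cauchy x ((b ℚ.* b) ℚ.* δ) (pos* (pos* 0<b 0<b) 0<δ) =
  M ℕ.⊔ N , λ {i} {j} p q → bound (seq x i) (seq x j)
    (b≤ (ℕ.m⊔n≤o⇒m≤o M N p)) (b≤ (ℕ.m⊔n≤o⇒m≤o M N q))
    (xc (ℕ.m⊔n≤o⇒n≤o M N p) (ℕ.m⊔n≤o⇒n≤o M N q))
  where
  open ℚ.≤-Reasoning

  b≤ : ∀ {i} → M ℕ.≤ i → b ℚ.≤ seq x i
  b≤ M≤i = ℚ.≤-trans (ℚ.≤-reflexive (sym (ℚ.+-identityˡ b))) (b≤x M≤i)

  bound : ∀ u v → b ℚ.≤ u → b ℚ.≤ v → ℚ.∣ u ℚ.- v ∣ ℚ.< (b ℚ.* b) ℚ.* δ →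
          ℚ.∣ recipℚ u ℚ.- recipℚ v ∣ ℚ.< δ
  bound u v b≤u b≤v u-v< = ℚ.*-cancelˡ-<-nonNeg (b ℚ.* b) {{nn-bb}} (begin-strict
    (b ℚ.* b) ℚ.* d      ≤⟨ ℚ.*-monoʳ-≤-nonNeg d {{nn-d}} bb≤uv ⟩
    (u ℚ.* v) ℚ.* d      ≡⟨ cong (ℚ._* d) (ℚ.0≤p⇒∣p∣≡p (ℚ.<⇒≤ 0<uv)) ⟨
    ℚ.∣ u ℚ.* v ∣ ℚ.* d  ≡⟨ ℚ.∣p*q∣≡∣p∣*∣q∣ (u ℚ.* v) (r ℚ.- s) ⟨
    ℚ.∣ (u ℚ.* v) ℚ.* (r ℚ.- s) ∣
      ≡⟨ cong ℚ.∣_∣ (*-distribˡ-‿ (u ℚ.* v) r s) ⟨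
    ℚ.∣ (u ℚ.* v) ℚ.* r ℚ.- (u ℚ.* v) ℚ.* s ∣
      ≡⟨ cong₂ (λ p q → ℚ.∣ p ℚ.- q ∣) uvr≡v uvs≡u ⟩
    ℚ.∣ v ℚ.- u ∣
      ≡⟨ cong ℚ.∣_∣ (-‿flip v u) ⟩
    ℚ.∣ ℚ.- (u ℚ.- v) ∣  ≡⟨ ℚ.∣-p∣≡∣p∣ (u ℚ.- v) ⟩
    ℚ.∣ u ℚ.- v ∣        <⟨ u-v< ⟩
    (b ℚ.* b) ℚ.* δ      ∎)
    where
    r = recipℚ u
    s = recipℚ v
    d = ℚ.∣ r ℚ.- s ∣
    0<u = ℚ.<-≤-trans 0<b b≤u
    0<v = ℚ.<-≤-trans 0<b b≤v
    0<uv = pos* 0<u 0<v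
    nn-d = ℚ.nonNegative (ℚ.0≤∣p∣ (r ℚ.- s))
    nn-bb = ℚ.nonNegative (ℚ.<⇒≤ (pos* 0<b 0<b))
    uvr≡v : (u ℚ.* v) ℚ.* r ≡ v
    uvr≡v = trans (cong (ℚ._* r) (ℚ.*-comm u v)) (trans (ℚ.*-assoc v u r)
      (trans (cong (v ℚ.*_) (recipℚ-inverse u 0<u)) (ℚ.*-identityʳ v)))
    uvs≡u : (u ℚ.* v) ℚ.* s ≡ u
    uvs≡u = trans (ℚ.*-assoc u v s)
      (trans (cong (u ℚ.*_) (recipℚ-inverse v 0<v)) (ℚ.*-identityʳ u))
    bb≤uv : b ℚ.* b ℚ.≤ u ℚ.* v
    bb≤uv = ℚ.≤-trans (ℚ.*-monoʳ-≤-nonNeg b {{ℚ.nonNegative (ℚ.<⇒≤ 0<b)}} b≤u)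
                      (ℚ.*-monoˡ-≤-nonNeg u {{ℚ.nonNegative (ℚ.<⇒≤ 0<u)}} b≤v)

recip : (x : ℝ) → 0ℝ < x → ℝ
recip x 0<x = mkℝ (λ i → recipℚ (seq x i)) (recip-cauchy x 0<x)

+-rawMonoid *-rawMonoid : RawMonoid 0ℓ 0ℓ
+-rawMonoid = record { _≈_ = _≃_ ; _∙_ = _+_ ; ε = 0ℝ }
*-rawMonoid = record { _≈_ = _≃_ ; _∙_ = _*_ ; ε = 1ℝ }

sumOver productOver : ∀ {m} → Subset m → (Fin m → ℝ) → ℝ
sumOver     F f = MonoidSum.sum +-rawMonoid (λ e → if lookup F e then f e else 0ℝ)
productOver F f = MonoidSum.sum *-rawMonoid (λ e → if lookup F e then f e else 1ℝ)

lookup-injective : ∀ {A : Set} {xs : List A} → Unique xs →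
                   Injective _≡_ _≡_ (List.lookup xs)
lookup-injective {xs = _ ∷ xs} (px ∷ u) {zero}  {zero}  eq = refl
lookup-injective {xs = _ ∷ xs} (px ∷ u) {zero}  {suc j} eq = ⊥-elim (All.lookup px (∈-lookup j) eq)
lookup-injective {xs = _ ∷ xs} (px ∷ u) {suc i} {zero}  eq = ⊥-elim (All.lookup px (∈-lookup i) (sym eq))
lookup-injective {xs = _ ∷ xs} (px ∷ u) {suc i} {suc j} eq = cong suc (lookup-injective u eq)

anyList? : ∀ {n} k {P : List (Fin n) → Set} → Decidable P →
           Dec (∃[ xs ] length xs ℕ.≤ k × P xs)
anyList? zero P? = map′ (λ p → [] , z≤n , p) (λ { ([] , _ , p) → p }) (P? [])
anyList? (suc k) {P} P? =
  map′ to from (P? [] ⊎-dec Fin.any? λ x → anyList? k (λ xs → P? (x ∷ xs)))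
  where
  to : P [] ⊎ (∃[ x ] ∃[ xs ] length xs ℕ.≤ k × P (x ∷ xs)) → ∃[ xs ] length xs ℕ.≤ suc k × P xs
  to (inj₁ p)                = [] , z≤n , p
  to (inj₂ (x , xs , l , p)) = x ∷ xs , s≤s l , p
  from : ∃[ xs ] length xs ℕ.≤ suc k × P xs → P [] ⊎ (∃[ x ] ∃[ xs ] length xs ℕ.≤ k × P (x ∷ xs))
  from ([]     , _     , p) = inj₁ p
  from (x ∷ xs , s≤s l , p) = inj₂ (x , xs , l , p)

-- The vertex set is Fin order and the edge set is Fin size; each edge is
-- stored as its pair of ends in increasing order, which rules out loops,
-- and injectivity of `ends` rules out parallel edges.
record Graph : Set where
  field
    order size : ℕ
    ends       : Fin size → Fin order × Fin order
    increasing : ∀ e → proj₁ (ends e) Fin.< proj₂ (ends e)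
    simple     : Injective _≡_ _≡_ ends

module _ (G : Graph) where
  open Graph G

  Vertex Edge : Set
  Vertex = Fin order
  Edge   = Fin size

  EdgeSet : Set
  EdgeSet = Subset size

  Adjacent : EdgeSet → Vertex → Vertex → Set
  Adjacent F u v = ∃[ e ] e ∈ F × (ends e ≡ (u , v) ⊎ ends e ≡ (v , u))

  -- (V(G), F) is connected, apart from the requirement that V(G) be nonempty.
  Connects : EdgeSet → Set
  Connects F = ∀ u v → Star (Adjacent F) u v

  -- x ∷ xs lists the vertices of a cycle in cyclic order.
  IsCycle : EdgeSet → Vertex → List Vertex → Set
  IsCycle F x xs =
    2 ℕ.≤ length xs × Unique (x ∷ xs) × Linked (Adjacent F) (x ∷ xs ∷ʳ x)

  Acyclic : EdgeSet → Set
  Acyclic F = ∀ x xs → ¬ IsCycle F x xs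

  IsSpanningTree : EdgeSet → Set
  IsSpanningTree T = Connects T × Acyclic T

  Connected : Set
  Connected = ℕ.NonZero order × Connects ⊤

  incident : Vertex → EdgeSet
  incident v = tabulate λ e →
    does (proj₁ (ends e) Fin.≟ v) ∨ does (proj₂ (ends e) Fin.≟ v)

  ∂ : Subset order → EdgeSet
  ∂ S = tabulate λ e → lookup S (proj₁ (ends e)) xor lookup S (proj₂ (ends e))

  adjacent? : ∀ F u v → Dec (Adjacent F u v)
  adjacent? F u v = Fin.any? λ e →
    (e ∈? F) ×-dec ((ends e ≟² (u , v)) ⊎-dec (ends e ≟² (v , u)))
    where _≟²_ = ≡-dec Fin._≟_ Fin._≟_

  module Reachability (F : EdgeSet) where

    -- Warshall's algorithm: `Via k _ u v` holds when v can be reached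
    -- from u with all intermediate vertices among the first k.
    Via : ∀ k → k ℕ.≤ order → Vertex → Vertex → Set
    Via zero    _   u v = u ≡ v ⊎ Adjacent F u v
    Via (suc k) k<n u v =
      Via k (ℕ.<⇒≤ k<n) u v ⊎ (Via k (ℕ.<⇒≤ k<n) u w × Via k (ℕ.<⇒≤ k<n) w v)
      where w = fromℕ< k<n

    via? : ∀ k k≤n u v → Dec (Via k k≤n u v)
    via? zero    _   u v = (u Fin.≟ v) ⊎-dec adjacent? F u v
    via? (suc k) k<n u v = via? k _ u v ⊎-dec (via? k _ u _ ×-dec via? k _ _ v)

    sound : ∀ k k≤n {u v} → Via k k≤n u v → Star (Adjacent F) u v
    sound zero    _   (inj₁ refl)    = ε
    sound zero    _   (inj₂ a)       = a ◅ ε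
    sound (suc k) k<n (inj₁ p)       = sound k _ p
    sound (suc k) k<n (inj₂ (p , q)) = sound k _ p ◅◅ sound k _ q

    weaken : ∀ k k≤n {u v} → Via 0 z≤n u v → Via k k≤n u v
    weaken zero    _   p = p
    weaken (suc k) k<n p = inj₁ (weaken k _ p)

    join : ∀ k k≤n {u w v} → toℕ w ℕ.< k → Via k k≤n u w → Via k k≤n w v → Via k k≤n u v
    join (suc k) k<n {u} {w} {v} w<1+k p q with toℕ w ℕ.≟ k
    ... | yes w≡k = inj₂ (fst p , snd q)
      where
      w≡ : w ≡ fromℕ< k<n
      w≡ = Fin.toℕ-injective (trans w≡k (sym (Fin.toℕ-fromℕ< k<n)))
      fst : Via (suc k) k<n u w → Via k _ u (fromℕ< k<n)
      fst (inj₁ a)       = subst (Via k _ u) w≡ a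
      fst (inj₂ (a , _)) = a
      snd : Via (suc k) k<n w v → Via k _ (fromℕ< k<n) v
      snd (inj₁ a)       = subst (λ z → Via k _ z v) w≡ a
      snd (inj₂ (_ , a)) = a
    ... | no w≢k = go p q
      where
      w<k = ℕ.≤∧≢⇒< (ℕ.≤-pred w<1+k) w≢k
      go : Via (suc k) k<n u w → Via (suc k) k<n w v → Via (suc k) k<n u v
      go (inj₁ a)       (inj₁ b)       = inj₁ (join k _ w<k a b)
      go (inj₁ a)       (inj₂ (b , c)) = inj₂ (join k _ w<k a b , c)
      go (inj₂ (a , b)) (inj₁ c)       = inj₂ (a , join k _ w<k b c)
      go (inj₂ (a , _)) (inj₂ (_ , c)) = inj₂ (a , c)

    complete : ∀ {u v} → Star (Adjacent F) u v → Via order ℕ.≤-refl u v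
    complete ε       = weaken order _ (inj₁ refl)
    complete (a ◅ p) = join order _ (Fin.toℕ<n _) (weaken order _ (inj₂ a)) (complete p)

    reachable? : ∀ u v → Dec (Star (Adjacent F) u v)
    reachable? u v = map′ (sound order _) complete (via? order _ u v)

  isCycle? : ∀ F x xs → Dec (IsCycle F x xs)
  isCycle? F x xs = (2 ℕ.≤? length xs) ×-dec DecUnique.unique? Fin._≟_ (x ∷ xs)
    ×-dec linked? (adjacent? F) (x ∷ xs ∷ʳ x)

  acyclic? : ∀ F → Dec (Acyclic F)
  acyclic? F = map′
    (λ none x xs c → none (x , xs , short c , c))
    (λ acyclic (x , xs , _ , c) → acyclic x xs c)
    (¬? (Fin.any? λ x → anyList? order (isCycle? F x)))
    where
    short : ∀ {x xs} → IsCycle F x xs → length xs ℕ.≤ order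
    short (_ , u , _) = ℕ.<⇒≤ (Fin.injective⇒≤ (lookup-injective u))

  isSpanningTree? : Decidable IsSpanningTree
  isSpanningTree? T =
    (Fin.all? λ u → Fin.all? λ v → Reachability.reachable? T u v) ×-dec acyclic? T

  IsFractionalHamiltonianCycle : (Edge → ℝ) → Set
  IsFractionalHamiltonianCycle f =
    (∀ e → 0ℝ ≤ f e × f e ≤ 1ℝ) ×
    sumOver ⊤ f ≃ fromℕ order ×
    (∀ S → Nonempty S → S ⊂ ⊤ → fromℕ 2 ≤ sumOver (∂ S) f)

  FractionallyHamiltonian : Set
  FractionallyHamiltonian = ∃[ f ] IsFractionalHamiltonianCycle f

allSubsets : ∀ m → List (Subset m)
allSubsets zero    = [] ∷ []
allSubsets (suc m) = map (outside ∷_) (allSubsets m) ++ map (inside ∷_) (allSubsets m)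

module _ (G : Graph) where
  open Graph G

  spanningTrees : List (EdgeSet G)
  spanningTrees = filter (isSpanningTree? G) (allSubsets size)

  weightSum : (Edge G → ℝ) → List (EdgeSet G) → ℝ
  weightSum c Ts = foldr _+_ 0ℝ (map (λ T → productOver T c) Ts)

  treeSum : (Edge G → ℝ) → ℝ
  treeSum c = weightSum c spanningTrees

  treeSumThrough : (Edge G → ℝ) → Edge G → ℝ
  treeSumThrough c e = weightSum c (filter (e ∈?_) spanningTrees)

  relativeResistance : (c : Edge G → ℝ) → 0ℝ < treeSum c → Edge G → ℝ
  relativeResistance c 0<τ e = treeSumThrough c e * recip (treeSum c) 0<τ

  curvature : (c : Edge G → ℝ) → 0ℝ < treeSum c → Vertex G → ℝ
  curvature c 0<τ v = 1ℝ - fromℚ ½ * sumOver (incident G v) (relativeResistance c 0<τ)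

  -- For positive weights on a connected graph treeSum c is automatically
  -- positive; the proof 0<τ is what makes the quotient meaningful.
  ResistancePositive : Set
  ResistancePositive =
    Σ[ c ∈ (Edge G → ℝ) ] (∀ e → 0ℝ < c e) ×
    Σ[ 0<τ ∈ 0ℝ < treeSum c ] (∀ v → 0ℝ < curvature c 0<τ v)

{-# OPTIONS --safe #-}
-- For k : V → ℕ let cost_k(T) = Σ_v k(v) deg_T(v). With weights c_uv = q^(n (k(u) + k(v))), q < 1
-- close to 1, a spanning tree T has weight q^(n cost_k(T)), and Σ_{e∋v} r_e(c) is the expected degree
-- of v. If that is at least 2 for some v, increment k(v): this multiplies the tree sum τ by less than
-- q^(2n - 1). But a fractional Hamiltonian cycle f forces the existence of a cheap spanning tree,
-- n cost_k(T) ≤ (2n - 1) Σ k, so τ ≥ q^((2n - 1) Σ k) always, and the process must stop.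
--
-- The cheap tree is found by Kruskal's algorithm with edge costs k(u) + k(v): whenever κ ≥ 2
-- components are left, the edges between them have f-mass at least κ, whereas only κ - 1 more
-- tree edges are needed, and κ - 1 ≤ κ (n - 1) / n. So the tree costs at most (n - 1) / n times the
-- f-cost, which is Σ_v k(v) f(∂v) = 2 Σ k. Replacing f by an integral approximation g / N loses
-- a little, which the bound (2n - 1) / n in place of (2n - 2) / n absorbs.
module Submission where

open import Algebra.Bundles using (CommutativeRing)
import Algebra.Definitions.RawMonoid as MonoidSum
open import Data.Bool.Base using (Bool; true; false; if_then_else_; _∨_; _xor_)
open import Data.Fin.Base as Fin using (Fin; zero; suc; punchOut; punchIn)
import Data.Fin.Properties as Fin
open import Data.Fin.Subset
  using (Subset; inside; outside; _∈_; _⊆_; _⊂_; Nonempty; ⊤; ⊥; ⁅_⁆; _∪_; ∣_∣)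
  renaming (_-_ to _∖_)
open import Data.Fin.Subset.Properties as Subset using (_∈?_; _⊂?_; nonempty?)
open import Data.Integer.Base as ℤ using (+_)
import Data.Integer.Properties as ℤ
open import Data.List.Base using (List; []; _∷_; _∷ʳ_; foldr; map; filter)
open import Data.List.Membership.Propositional using () renaming (_∈_ to _∈ˡ_)
open import Data.List.Membership.Propositional.Properties using (∈-filter⁺; ∈-map⁺; ∈-++⁺ˡ; ∈-++⁺ʳ)
open import Data.List.Properties using (filter-accept; filter-reject)
open import Data.List.Relation.Unary.All as All using (All; []; _∷_)
open import Data.List.Relation.Unary.AllPairs using (_∷_)
open import Data.List.Relation.Unary.Any using (here; there)
open import Data.List.Relation.Unary.Linked using (Linked; _∷_)
open import Data.Nat.Base as ℕ using (ℕ; zero; suc; pred; z≤n; s≤s; NonZero)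
import Data.Nat.Properties as ℕ
open import Data.Nat.Tactic.RingSolver using (solve-∀)
open import Data.Product.Base using (∃; ∃-syntax; _×_; _,_; proj₁; proj₂)
open import Data.Rational.Base as ℚ using (ℚ; 0ℚ; 1ℚ; ½)
import Data.Rational.Properties as ℚ
open import Data.Rational.Solver using (module +-*-Solver)
import Data.Rational.Unnormalised.Base as ℚᵘ
import Data.Rational.Unnormalised.Properties as ℚᵘ
open import Data.Sum.Base as Sum using (_⊎_; inj₁; inj₂)
open import Data.Vec.Base using (lookup; tabulate; []; _∷_)
open import Data.Vec.Properties using (lookup∘tabulate; lookup⇒[]=; []=⇒lookup; lookup-replicate)
open import Function.Base using (_∘_; id; case_of_)
open import Relation.Binary.Construct.Closure.ReflexiveTransitive
  using (Star; ε; _◅_; reverse; kleisliStar; return)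
open import Relation.Binary.PropositionalEquality
open import Relation.Nullary using (Dec; yes; no; does; ¬_; contradiction)
open import Relation.Nullary.Decidable using (_×-dec_; ¬?; dec-true; dec-false)
open import Relation.Unary using (Decidable)

open import Algebra.Properties.Semiring.Sum ℕ.+-*-semiring
  using (sum; sum-syntax; sum-cong-≗; sum-replicate-zero; ∑-distrib-+; ∑-comm; *-distribˡ-sum; *-distribʳ-sum)
import Algebra.Properties.Semiring.Sum (CommutativeRing.semiring ℚ.+-*-commutativeRing) as ℚΣ
import Algebra.Properties.Semiring.Exp (CommutativeRing.semiring ℚ.+-*-commutativeRing) as Exp
open Exp using (_^_)

open import Defs

-- Indicator sums and weights of edge sets over the natural numbers.

⟦_⟧ : Bool → ℕ
⟦ b ⟧ = if b then 1 else 0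

⟦⟧-≤ : ∀ {b n} → (b ≡ true → 1 ℕ.≤ n) → ⟦ b ⟧ ℕ.≤ n
⟦⟧-≤ {false} _ = z≤n
⟦⟧-≤ {true}  h = h refl

⟦⟧≤1 : ∀ b → ⟦ b ⟧ ℕ.≤ 1
⟦⟧≤1 false = z≤n
⟦⟧≤1 true  = ℕ.≤-refl

⟦∨⟧≤ : ∀ a b → ⟦ a ∨ b ⟧ ℕ.≤ ⟦ a ⟧ ℕ.+ ⟦ b ⟧
⟦∨⟧≤ false b = ℕ.≤-refl
⟦∨⟧≤ true  b = s≤s z≤n

⟦xor⟧≤ : ∀ a b → ⟦ a xor b ⟧ ℕ.≤ ⟦ a ⟧ ℕ.+ ⟦ b ⟧
⟦xor⟧≤ false b     = ℕ.≤-refl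
⟦xor⟧≤ true  false = ℕ.≤-refl
⟦xor⟧≤ true  true  = z≤n

sum-mono : ∀ {n} {f g : Fin n → ℕ} → (∀ i → f i ℕ.≤ g i) → sum f ℕ.≤ sum g
sum-mono {zero}  f≤g = z≤n
sum-mono {suc n} f≤g = ℕ.+-mono-≤ (f≤g zero) (sum-mono (f≤g ∘ suc))

term≤sum : ∀ {n} (f : Fin n → ℕ) i → f i ℕ.≤ sum f
term≤sum f zero    = ℕ.m≤m+n _ _
term≤sum f (suc i) = ℕ.≤-trans (term≤sum (f ∘ suc) i) (ℕ.m≤n+m _ _)

sum-const : ∀ n c → ∑[ i < n ] c ≡ n ℕ.* c
sum-const zero    c = refl
sum-const (suc n) c = cong (c ℕ.+_) (sum-const n c)

sum-δ : ∀ {n} (x : Fin n) (f : Fin n → ℕ) → ∑[ i < n ] (⟦ does (x Fin.≟ i) ⟧ ℕ.* f i) ≡ f x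
sum-δ {suc n} zero f = trans (cong₂ ℕ._+_ (ℕ.*-identityˡ (f zero)) (sum-replicate-zero n)) (ℕ.+-identityʳ _)
sum-δ {suc n} (suc x) f = sum-δ x (f ∘ suc)

-- The surpluses `a j ∸ b` add up to at most `r`, so no single one can exceed `r`.
excess-≤ : ∀ {n} (a : Fin n → ℕ) b r → (∀ i → b ℕ.≤ a i) → sum a ℕ.≤ n ℕ.* b ℕ.+ r →
           ∀ i → a i ℕ.≤ b ℕ.+ r
excess-≤ {n} a b r b≤a total i = begin
  a i                  ≡⟨ ℕ.m+[n∸m]≡n (b≤a i) ⟨
  b ℕ.+ (a i ℕ.∸ b)    ≤⟨ ℕ.+-monoʳ-≤ b (term≤sum (λ j → a j ℕ.∸ b) i) ⟩
  b ℕ.+ ∑[ j < n ] (a j ℕ.∸ b)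
    ≤⟨ ℕ.+-monoʳ-≤ b (ℕ.+-cancelˡ-≤ (n ℕ.* b) _ _ (ℕ.≤-trans (ℕ.≤-reflexive eq) total)) ⟩
  b ℕ.+ r              ∎
  where
  open ℕ.≤-Reasoning
  eq : n ℕ.* b ℕ.+ ∑[ j < n ] (a j ℕ.∸ b) ≡ sum a
  eq = trans (cong (ℕ._+ ∑[ j < n ] (a j ℕ.∸ b)) (sym (sum-const n b)))
      (trans (sym (∑-distrib-+ (λ _ → b) (λ j → a j ℕ.∸ b)))
             (sum-cong-≗ (λ j → ℕ.m+[n∸m]≡n (b≤a j))))

weight : ∀ {m} → Subset m → (Fin m → ℕ) → ℕ
weight {m} F w = ∑[ e < m ] (⟦ lookup F e ⟧ ℕ.* w e)

weight-⊆ : ∀ {m} {F H : Subset m} w → F ⊆ H → weight F w ℕ.≤ weight H w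
weight-⊆ w F⊆H = sum-mono λ e → ℕ.*-monoˡ-≤ (w e) (⟦⟧-≤ λ eq →
  ℕ.≤-reflexive (cong ⟦_⟧ (sym ([]=⇒lookup (F⊆H (lookup⇒[]= e _ eq))))))

weight-insert : ∀ {m} (F : Subset m) e w → weight (⁅ e ⁆ ∪ F) w ℕ.≤ w e ℕ.+ weight F w
weight-insert {m} F e w = begin
  weight (⁅ e ⁆ ∪ F) w
    ≤⟨ sum-mono (λ i → ℕ.*-monoˡ-≤ (w i) (⟦⟧-≤ (one i))) ⟩
  ∑[ i < m ] ((⟦ does (e Fin.≟ i) ⟧ ℕ.+ ⟦ lookup F i ⟧) ℕ.* w i)
    ≡⟨ sum-cong-≗ (λ i → ℕ.*-distribʳ-+ (w i) ⟦ does (e Fin.≟ i) ⟧ ⟦ lookup F i ⟧) ⟩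
  ∑[ i < m ] (⟦ does (e Fin.≟ i) ⟧ ℕ.* w i ℕ.+ ⟦ lookup F i ⟧ ℕ.* w i)
    ≡⟨ ∑-distrib-+ (λ i → ⟦ does (e Fin.≟ i) ⟧ ℕ.* w i) _ ⟩
  ∑[ i < m ] (⟦ does (e Fin.≟ i) ⟧ ℕ.* w i) ℕ.+ weight F w
    ≡⟨ cong (ℕ._+ weight F w) (sum-δ e w) ⟩
  w e ℕ.+ weight F w ∎
  where
  open ℕ.≤-Reasoning
  one : ∀ i → lookup (⁅ e ⁆ ∪ F) i ≡ true → 1 ℕ.≤ ⟦ does (e Fin.≟ i) ⟧ ℕ.+ ⟦ lookup F i ⟧
  one i eq with Subset.x∈p∪q⁻ ⁅ e ⁆ F (lookup⇒[]= i _ eq)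
  ... | inj₁ i∈e rewrite Subset.x∈⁅y⁆⇒x≡y e i∈e | dec-true (e Fin.≟ e) refl = s≤s z≤n
  ... | inj₂ i∈F rewrite []=⇒lookup i∈F = ℕ.m≤n+m 1 _

weight-+ : ∀ {m} (F : Subset m) v w → weight F (λ e → v e ℕ.+ w e) ≡ weight F v ℕ.+ weight F w
weight-+ {m} F v w = trans (sum-cong-≗ {m} λ e → ℕ.*-distribˡ-+ ⟦ lookup F e ⟧ (v e) (w e))
                           (∑-distrib-+ {m} _ _)

weight-*ˡ : ∀ {m} (F : Subset m) a w → weight F (λ e → a ℕ.* w e) ≡ a ℕ.* weight F w
weight-*ˡ {m} F a w = sym (trans (*-distribˡ-sum {m} a _) (sum-cong-≗ {m} λ e → swap a ⟦ lookup F e ⟧ (w e)))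
  where
  swap : ∀ x y z → x ℕ.* (y ℕ.* z) ≡ y ℕ.* (x ℕ.* z)
  swap = solve-∀

weight-⊥ : ∀ {m} w → weight (⊥ {m}) w ≡ 0
weight-⊥ {zero}  w = refl
weight-⊥ {suc m} w = weight-⊥ (w ∘ suc)

minimal : ∀ {m} {P : Fin m → Set} → Decidable P → (w : Fin m → ℕ) →
          (∀ i → ¬ P i) ⊎ (∃[ i ] P i × (∀ j → P j → w i ℕ.≤ w j))
minimal {zero}  P? w = inj₁ λ ()
minimal {suc m} P? w with P? zero | minimal (P? ∘ suc) (w ∘ suc)
... | no ¬p | inj₁ none = inj₁ λ { zero → ¬p ; (suc i) → none i }
... | no ¬p | inj₂ (i , pi , least) =
  inj₂ (suc i , pi , λ { zero p → contradiction p ¬p ; (suc j) → least j })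
... | yes p | inj₁ none =
  inj₂ (zero , p , λ { zero _ → ℕ.≤-refl ; (suc j) pj → contradiction pj (none j) })
... | yes p | inj₂ (i , pi , least) with ℕ.≤-total (w zero) (w (suc i))
...   | inj₁ w₀≤ = inj₂ (zero , p , λ { zero _ → ℕ.≤-refl ; (suc j) pj → ℕ.≤-trans w₀≤ (least j pj) })
...   | inj₂ ≤w₀ = inj₂ (suc i , pi , λ { zero _ → ≤w₀ ; (suc j) → least j })

-- Pruning a connecting edge set to a spanning tree.

module _ (G : Graph) where
  open Graph G

  private
    variable
      u v x y : Vertex G
      F H : EdgeSet G
      e : Edge G

  source target : Edge G → Vertex G
  source e = proj₁ (ends e)
  target e = proj₂ (ends e)

  adjacent-sym : Adjacent G F u v → Adjacent G F v u
  adjacent-sym (e , e∈F , eq) = e , e∈F , Sum.swap eq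

  adjacent-⊆ : F ⊆ H → Adjacent G F u v → Adjacent G H u v
  adjacent-⊆ F⊆H (e , e∈F , eq) = e , F⊆H e∈F , eq

  connects? : ∀ F → Dec (Connects G F)
  connects? F = Fin.all? λ u → Fin.all? λ v → Reachability.reachable? G F u v

  same-ends : ∀ {u v x y : Vertex G} {p} → p ≡ (u , v) ⊎ p ≡ (v , u) → p ≡ (x , y) ⊎ p ≡ (y , x) →
              (u ≡ x × v ≡ y) ⊎ (u ≡ y × v ≡ x)
  same-ends (inj₁ refl) (inj₁ refl) = inj₁ (refl , refl)
  same-ends (inj₁ refl) (inj₂ refl) = inj₂ (refl , refl)
  same-ends (inj₂ refl) (inj₁ refl) = inj₂ (refl , refl)
  same-ends (inj₂ refl) (inj₂ refl) = inj₁ (refl , refl)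

  -- A walk that uses `e` can follow the given detour between its ends instead, forwards or
  -- reversed.
  connects-remove : Connects G F → ends e ≡ (x , y) ⊎ ends e ≡ (y , x) →
                    Star (Adjacent G (F ∖ e)) y x → Connects G (F ∖ e)
  connects-remove {F} {e} {x} {y} conn exy y⇝x u v = kleisliStar id detour (conn u v)
    where
    detour : ∀ {u v} → Adjacent G F u v → Star (Adjacent G (F ∖ e)) u v
    detour (e′ , e′∈F , eq) with e′ Fin.≟ e
    ... | no e′≢e = return (e′ , Subset.x∈p∧x≢y⇒x∈p-y e′∈F e′≢e , eq)
    ... | yes refl with same-ends eq exy
    ...   | inj₁ (refl , refl) = reverse adjacent-sym y⇝x
    ...   | inj₂ (refl , refl) = y⇝x

  -- The edge joining the first two vertices `x` and `y` can go. Every other step of the cycle has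
  -- an end outside `x` and `y`, so it is not along `e`, and these steps lead from `y` back to `x`.
  cycle⇒removable : ∀ {xs} → Connects G F → IsCycle G F x xs → ∃[ e ] e ∈ F × Connects G (F ∖ e)
  cycle⇒removable {xs = _ ∷ []} _ (s≤s () , _)
  cycle⇒removable {F} {x} {y ∷ z ∷ zs} conn
    (_ , (_ ∷ x≢z ∷ x≢zs) ∷ (y≢z ∷ y≢zs) ∷ _ , (e , e∈F , exy) ∷ yz ∷ link) =
    e , e∈F , connects-remove conn exy
      (adjacent-sym (avoid (x≢z ∘ sym) (y≢z ∘ sym) (adjacent-sym yz))
        ◅ walk z zs (x≢z ∘ sym) (y≢z ∘ sym) (All.map (_∘ sym) x≢zs) (All.map (_∘ sym) y≢zs) link)
    where
    avoid : ∀ {a b} → a ≢ x → a ≢ y → Adjacent G F a b → Adjacent G (F ∖ e) a b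
    avoid a≢x a≢y (e′ , e′∈F , eq) = e′ , Subset.x∈p∧x≢y⇒x∈p-y e′∈F
      (λ { refl → Sum.[ a≢x ∘ proj₁ , a≢y ∘ proj₁ ] (same-ends eq exy) }) , eq
    walk : ∀ a as → a ≢ x → a ≢ y → All (_≢ x) as → All (_≢ y) as →
           Linked (Adjacent G F) (a ∷ as ∷ʳ x) → Star (Adjacent G (F ∖ e)) a x
    walk a []       p q _        _        (l ∷ _)  = return (avoid p q l)
    walk a (b ∷ as) p q (r ∷ rs) (s ∷ ss) (l ∷ ls) = avoid p q l ◅ walk b as r s rs ss ls

  -- Edges are deleted as long as the rest still connects the graph. When none can be deleted, the
  -- set is acyclic, because a cycle would contain a removable edge. The bound `k` on the
  -- cardinality drives the recursion.
  connects⇒spanningTree : ∀ k F → ∣ F ∣ ℕ.≤ k → Connects G F → ∃[ T ] T ⊆ F × IsSpanningTree G T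
  connects⇒spanningTree k F size≤k conn
    with Fin.any? (λ e → (e ∈? F) ×-dec connects? (F ∖ e))
  ... | no none = F , id , conn , λ x xs cyc → none (cycle⇒removable conn cyc)
  connects⇒spanningTree zero F size≤0 conn | yes (e , e∈F , _) =
    contradiction (ℕ.≤-trans (Subset.x∈p⇒∣p-x∣<∣p∣ e∈F) size≤0) ℕ.n≮0
  connects⇒spanningTree (suc k) F size≤k conn | yes (e , e∈F , conn′)
    with T , T⊆ , tree ← connects⇒spanningTree k (F ∖ e)
           (ℕ.≤-pred (ℕ.≤-trans (Subset.x∈p⇒∣p-x∣<∣p∣ e∈F) size≤k)) conn′ =
    T , (λ t → Subset.p─q⊆p F ⁅ e ⁆ (T⊆ t)) , tree

-- Kruskal's algorithm against a fractional cycle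

merge : ∀ {n} {i j : Fin (suc n)} → i ≢ j → Fin (suc n) → Fin n
merge {j = j} i≢j a with j Fin.≟ a
... | yes _  = punchOut (i≢j ∘ sym)
... | no j≢a = punchOut j≢a

merge-kernel : ∀ {n} {i j : Fin (suc n)} (i≢j : i ≢ j) a b → merge i≢j a ≡ merge i≢j b →
               a ≡ b ⊎ (a ≡ i × b ≡ j) ⊎ (a ≡ j × b ≡ i)
merge-kernel {j = j} i≢j a b eq with j Fin.≟ a | j Fin.≟ b
... | yes refl | yes refl = inj₁ refl
... | yes refl | no j≢b   = inj₂ (inj₂ (refl , sym (Fin.punchOut-injective (i≢j ∘ sym) j≢b eq)))
... | no j≢a   | yes refl = inj₂ (inj₁ (Fin.punchOut-injective j≢a (i≢j ∘ sym) eq , refl))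
... | no j≢a   | no j≢b   = inj₁ (Fin.punchOut-injective j≢a j≢b eq)

merge-surjective : ∀ {n} {i j : Fin (suc n)} (i≢j : i ≢ j) c → merge i≢j (punchIn j c) ≡ c
merge-surjective {j = j} i≢j c with j Fin.≟ punchIn j c
... | yes j≡ = contradiction (sym j≡) (Fin.punchInᵢ≢i j c)
... | no j≢  = Fin.punchOut-punchIn j

other : ∀ {n} → 2 ℕ.≤ n → (i : Fin n) → ∃[ j ] j ≢ i
other (s≤s (s≤s _)) i = punchIn i zero , Fin.punchInᵢ≢i i zero

-- The inequality (κ - 1) / κ ≤ (n - 1) / n without denominators. It makes the saving factor for `κ`
-- classes uniform in `κ`.
*-pred-≤ : ∀ {κ n} → κ ℕ.≤ n → n ℕ.* pred κ ℕ.≤ pred n ℕ.* κ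
*-pred-≤ {n = n} z≤n = ℕ.≤-reflexive (trans (ℕ.*-zeroʳ n) (sym (ℕ.*-zeroʳ (pred n))))
*-pred-≤ {suc κ} {suc n} (s≤s κ≤n) = begin
  κ ℕ.+ n ℕ.* κ    ≤⟨ ℕ.+-monoˡ-≤ (n ℕ.* κ) κ≤n ⟩
  n ℕ.+ n ℕ.* κ    ≡⟨ ℕ.*-suc n κ ⟨
  n ℕ.* suc κ      ∎
  where open ℕ.≤-Reasoning

module _ (G : Graph) where
  open Graph G

  ends-at : Vertex G → Edge G → ℕ
  ends-at v e = ⟦ does (source G e Fin.≟ v) ⟧ ℕ.+ ⟦ does (target G e Fin.≟ v) ⟧

  endpointSum : (Vertex G → ℕ) → Edge G → ℕ
  endpointSum k e = k (source G e) ℕ.+ k (target G e)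

  endpointSum-ends-at : ∀ k e → ∑[ v < order ] (ends-at v e ℕ.* k v) ≡ endpointSum k e
  endpointSum-ends-at k e = trans
    (sum-cong-≗ {order} (λ v → ℕ.*-distribʳ-+ (k v) ⟦ does (source G e Fin.≟ v) ⟧ ⟦ does (target G e Fin.≟ v) ⟧))
    (trans (∑-distrib-+ {order} _ _) (cong₂ ℕ._+_ (sum-δ (source G e) k) (sum-δ (target G e) k)))

  -- Double counting of the pairs of an edge and one of its ends. With `x = g` it turns the cost of
  -- the fractional cycle into vertex loads; with `k` constantly 1 it counts each edge twice.
  handshake : ∀ k (x : Edge G → ℕ) → ∑[ e < size ] (x e ℕ.* endpointSum k e) ≡
              ∑[ v < order ] (k v ℕ.* ∑[ e < size ] (x e ℕ.* ends-at v e))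
  handshake k x = begin
    ∑[ e < size ] (x e ℕ.* endpointSum k e)
      ≡⟨ sum-cong-≗ {size} (λ e → cong (x e ℕ.*_) (sym (endpointSum-ends-at k e))) ⟩
    ∑[ e < size ] (x e ℕ.* ∑[ v < order ] (ends-at v e ℕ.* k v))
      ≡⟨ sum-cong-≗ {size} (λ e → *-distribˡ-sum {order} (x e) _) ⟩
    ∑[ e < size ] ∑[ v < order ] (x e ℕ.* (ends-at v e ℕ.* k v))
      ≡⟨ ∑-comm {size} {order} _ ⟩
    ∑[ v < order ] ∑[ e < size ] (x e ℕ.* (ends-at v e ℕ.* k v))
      ≡⟨ sum-cong-≗ {order} (λ v → sum-cong-≗ {size} (λ e → rotate (x e) (ends-at v e) (k v))) ⟩
    ∑[ v < order ] ∑[ e < size ] (k v ℕ.* (x e ℕ.* ends-at v e))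
      ≡⟨ sum-cong-≗ {order} (λ v → *-distribˡ-sum {size} (k v) _) ⟨
    ∑[ v < order ] (k v ℕ.* ∑[ e < size ] (x e ℕ.* ends-at v e)) ∎
    where
    open ≡-Reasoning
    rotate : ∀ x y z → x ℕ.* (y ℕ.* z) ≡ z ℕ.* (x ℕ.* y)
    rotate = solve-∀


-- An integral version of a fractional Hamiltonian cycle: g / N satisfies the cut condition.
module Cuts (G : Graph) (g : Edge G → ℕ) (N : ℕ)
  (cut : ∀ S → Nonempty S → S ⊂ ⊤ → 2 ℕ.* N ℕ.≤ weight (∂ G S) g) where

  open Graph G

  module _ {κ} (ℓ : Vertex G → Fin κ) where

    class : Fin κ → Subset order
    class i = tabulate λ v → does (ℓ v Fin.≟ i)

    crosses? : Decidable (λ e → ℓ (source G e) ≢ ℓ (target G e))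
    crosses? e = ¬? (ℓ (source G e) Fin.≟ ℓ (target G e))

    crossing : EdgeSet G
    crossing = tabulate (does ∘ crosses?)

    ∈class⁺ : ∀ {v i} → ℓ v ≡ i → v ∈ class i
    ∈class⁺ {v} {i} eq = lookup⇒[]= v _ (trans (lookup∘tabulate _ v) (dec-true (ℓ v Fin.≟ i) eq))

    ∈class⁻ : ∀ {v i} → v ∈ class i → ℓ v ≡ i
    ∈class⁻ {v} {i} v∈ with ℓ v Fin.≟ i | trans (sym (lookup∘tabulate (λ v → does (ℓ v Fin.≟ i)) v)) ([]=⇒lookup v∈)
    ... | yes eq | _ = eq

    lookup-∂class : ∀ i e → lookup (∂ G (class i)) e ≡
                    does (ℓ (source G e) Fin.≟ i) xor does (ℓ (target G e) Fin.≟ i)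
    lookup-∂class i e = trans (lookup∘tabulate _ e)
      (cong₂ _xor_ (lookup∘tabulate _ (source G e)) (lookup∘tabulate _ (target G e)))

    module _ (onto : ∀ i → ∃[ v ] ℓ v ≡ i) (2≤κ : 2 ℕ.≤ κ) where

      -- The cut condition applies because `onto` puts a vertex in the class and `2 ≤ κ` supplies
      -- another class, hence a vertex outside it.
      cut-class : ∀ i → 2 ℕ.* N ℕ.≤ weight (∂ G (class i)) g
      cut-class i with v , v∈i ← onto i | j , j≢i ← other 2≤κ i with u , u∈j ← onto j =
        cut (class i) (v , ∈class⁺ v∈i)
          ((λ _ → Subset.∈⊤) , u , Subset.∈⊤ , λ u∈i → j≢i (trans (sym u∈j) (∈class⁻ u∈i)))

      -- An edge between two classes lies on the boundaries of just those two, and an edge inside a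
      -- class lies on none.
      boundary-count : ∀ a b → ∑[ i < κ ] ⟦ does (a Fin.≟ i) xor does (b Fin.≟ i) ⟧ ℕ.≤
                       2 ℕ.* ⟦ does (¬? (a Fin.≟ b)) ⟧
      boundary-count a b with a Fin.≟ b
      ... | yes refl = ℕ.≤-reflexive (trans (sum-cong-≗ {κ} (λ i → cong ⟦_⟧ (xor-self (does (a Fin.≟ i)))))
                                            (sum-replicate-zero κ))
        where
        xor-self : ∀ x → x xor x ≡ false
        xor-self false = refl
        xor-self true  = refl
      ... | no _ = begin
        ∑[ i < κ ] ⟦ does (a Fin.≟ i) xor does (b Fin.≟ i) ⟧
          ≤⟨ sum-mono (λ i → ⟦xor⟧≤ (does (a Fin.≟ i)) _) ⟩
        ∑[ i < κ ] (⟦ does (a Fin.≟ i) ⟧ ℕ.+ ⟦ does (b Fin.≟ i) ⟧)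
          ≡⟨ ∑-distrib-+ {κ} _ _ ⟩
        ∑[ i < κ ] ⟦ does (a Fin.≟ i) ⟧ ℕ.+ ∑[ i < κ ] ⟦ does (b Fin.≟ i) ⟧
          ≡⟨ cong₂ ℕ._+_ (one a) (one b) ⟩
        2 ∎
        where
        open ℕ.≤-Reasoning
        one : ∀ c → ∑[ i < κ ] ⟦ does (c Fin.≟ i) ⟧ ≡ 1
        one c = trans (sum-cong-≗ {κ} (λ i → sym (ℕ.*-identityʳ _))) (sum-δ c (λ _ → 1))

      -- Adding the cut conditions of all `κ` classes counts every crossing edge at most twice,
      -- which cancels the 2 in the cut condition.
      crossing-heavy : κ ℕ.* N ℕ.≤ weight crossing g
      crossing-heavy = ℕ.*-cancelˡ-≤ 2 (begin
        2 ℕ.* (κ ℕ.* N)                            ≡⟨ swap 2 κ N ⟩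
        κ ℕ.* (2 ℕ.* N)                            ≡⟨ sum-const κ _ ⟨
        ∑[ i < κ ] (2 ℕ.* N)                       ≤⟨ sum-mono cut-class ⟩
        ∑[ i < κ ] ∑[ e < size ] (⟦ lookup (∂ G (class i)) e ⟧ ℕ.* g e)
          ≡⟨ ∑-comm {κ} {size} _ ⟩
        ∑[ e < size ] ∑[ i < κ ] (⟦ lookup (∂ G (class i)) e ⟧ ℕ.* g e)
          ≡⟨ sum-cong-≗ {size} (λ e → *-distribʳ-sum {κ} (g e) (λ i → ⟦ lookup (∂ G (class i)) e ⟧)) ⟨
        ∑[ e < size ] (∑[ i < κ ] ⟦ lookup (∂ G (class i)) e ⟧ ℕ.* g e)
          ≤⟨ sum-mono (λ e → ℕ.*-monoˡ-≤ (g e) (count e)) ⟩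
        ∑[ e < size ] (2 ℕ.* ⟦ lookup crossing e ⟧ ℕ.* g e)
          ≡⟨ sum-cong-≗ {size} (λ e → ℕ.*-assoc 2 ⟦ lookup crossing e ⟧ (g e)) ⟩
        ∑[ e < size ] (2 ℕ.* (⟦ lookup crossing e ⟧ ℕ.* g e))
          ≡⟨ *-distribˡ-sum {size} 2 _ ⟨
        2 ℕ.* weight crossing g ∎)
        where
        open ℕ.≤-Reasoning
        swap : ∀ x y z → x ℕ.* (y ℕ.* z) ≡ y ℕ.* (x ℕ.* z)
        swap = solve-∀
        count : ∀ e → ∑[ i < κ ] ⟦ lookup (∂ G (class i)) e ⟧ ℕ.≤ 2 ℕ.* ⟦ lookup crossing e ⟧
        count e = subst₂ ℕ._≤_
          (sum-cong-≗ {κ} (λ i → cong ⟦_⟧ (sym (lookup-∂class i e))))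
          (cong (λ b → 2 ℕ.* ⟦ b ⟧) (sym (lookup∘tabulate (does ∘ crosses?) e)))
          (boundary-count (ℓ (source G e)) (ℓ (target G e)))

  -- Adjacency in the graph with the classes of `ℓ` contracted, expressed on the original vertices:
  -- moving within a class is free.
  JoinedBy : ∀ {κ} → (Vertex G → Fin κ) → EdgeSet G → Vertex G → Vertex G → Set
  JoinedBy ℓ F u v = ℓ u ≡ ℓ v ⊎ Adjacent G F u v

  ConnectsClasses : ∀ {κ} → (Vertex G → Fin κ) → EdgeSet G → Set
  ConnectsClasses ℓ F = ∀ u v → Star (JoinedBy ℓ F) u v

  module _ .{{_ : NonZero N}} where

    -- Some edge must cross, since the crossing edges carry mass at least `κ * N`, which is
    -- positive.
    lightest-crossing : ∀ {κ} (ℓ : Vertex G → Fin κ) → (∀ i → ∃[ v ] ℓ v ≡ i) → 2 ℕ.≤ κ →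
      ∀ w → ∃[ e ] ℓ (source G e) ≢ ℓ (target G e) ×
            (∀ j → ℓ (source G j) ≢ ℓ (target G j) → w e ℕ.≤ w j)
    lightest-crossing {κ} ℓ onto 2≤κ w with minimal (crosses? ℓ) w
    ... | inj₂ found = found
    ... | inj₁ none  = contradiction (begin
      2                        ≤⟨ 2≤κ ⟩
      κ                        ≤⟨ ℕ.m≤m*n κ N ⟩
      κ ℕ.* N                  ≤⟨ crossing-heavy ℓ onto 2≤κ ⟩
      weight (crossing ℓ) g    ≡⟨ sum-cong-≗ {size} (λ e → cong (λ b → ⟦ b ⟧ ℕ.* g e)
                                   (trans (lookup∘tabulate _ e) (dec-false (crosses? ℓ e) (none e)))) ⟩
      ∑[ e < size ] 0          ≡⟨ sum-replicate-zero size ⟩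
      0                        ∎) λ ()
      where open ℕ.≤-Reasoning

    -- The last condition says w(F) ≤ (n - 1) / n times the sum of (g / N) w over the crossing
    -- edges. The bound on the cardinality of `F` limits what is lost when a constant is added back
    -- to all weights.
    LightConnector : ∀ κ → (Vertex G → Fin κ) → (Edge G → ℕ) → Set
    LightConnector κ ℓ w =
      ∃[ F ] weight F (λ _ → 1) ℕ.≤ pred κ × ConnectsClasses ℓ F ×
             order ℕ.* N ℕ.* weight F w ℕ.≤ pred order ℕ.* weight (crossing ℓ) (λ e → g e ℕ.* w e)

    no-edges : ∀ {κ} (ℓ : Vertex G → Fin κ) → (∀ u v → ℓ u ≡ ℓ v) →
               ∀ w → LightConnector κ ℓ w
    no-edges ℓ same w = ⊥ ,
      subst (ℕ._≤ _) (sym (weight-⊥ {size} (λ _ → 1))) z≤n ,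
      (λ u v → return (inj₁ (same u v))) ,
      ℕ.≤-trans (ℕ.≤-reflexive (trans (cong (order ℕ.* N ℕ.*_) (weight-⊥ {size} w)) (ℕ.*-zeroʳ (order ℕ.* N)))) z≤n

    -- Each class contributes at least N to g(crossing ℓ), which pays for subtracting w e₀ from
    -- all the weights, with the factor (n - 1) / n to spare.
    contract : ∀ k (ℓ : Vertex G → Fin (suc (suc k))) → (∀ i → ∃[ v ] ℓ v ≡ i) → suc (suc k) ℕ.≤ order →
      ∀ w e₀ (crosses : ℓ (source G e₀) ≢ ℓ (target G e₀)) →
      (∀ e → ℓ (source G e) ≢ ℓ (target G e) → w e₀ ℕ.≤ w e) →
      LightConnector (suc k) (merge crosses ∘ ℓ) (λ e → w e ℕ.∸ w e₀) →
      LightConnector (suc (suc k)) ℓ w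
    contract k ℓ onto κ≤n w e₀ crosses least (F , few , conn , light) =
      ⁅ e₀ ⁆ ∪ F ,
      ℕ.≤-trans (weight-insert F e₀ _) (s≤s few) ,
      (λ u v → kleisliStar id lift (conn u v)) ,
      (begin
        n ℕ.* N ℕ.* weight (⁅ e₀ ⁆ ∪ F) w
          ≤⟨ ℕ.*-monoʳ-≤ (n ℕ.* N) (ℕ.≤-trans (weight-insert F e₀ w) (ℕ.+-monoʳ-≤ m restore)) ⟩
        n ℕ.* N ℕ.* (m ℕ.+ (W′ ℕ.+ m ℕ.* k))
          ≡⟨ arrange₁ n N m W′ k ⟩
        n ℕ.* N ℕ.* W′ ℕ.+ n ℕ.* suc k ℕ.* (N ℕ.* m)
          ≤⟨ ℕ.+-mono-≤
               (ℕ.≤-trans light (ℕ.*-monoʳ-≤ p (weight-⊆ _ crossing-⊆)))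
               (ℕ.*-monoˡ-≤ (N ℕ.* m) (*-pred-≤ κ≤n)) ⟩
        p ℕ.* C′ ℕ.+ p ℕ.* suc (suc k) ℕ.* (N ℕ.* m)
          ≡⟨ arrange₂ p C′ (suc (suc k)) N m ⟩
        p ℕ.* (C′ ℕ.+ m ℕ.* (suc (suc k) ℕ.* N))
          ≤⟨ ℕ.*-monoʳ-≤ p (ℕ.+-monoʳ-≤ C′ (ℕ.*-monoʳ-≤ m (crossing-heavy ℓ onto (s≤s (s≤s z≤n))))) ⟩
        p ℕ.* (C′ ℕ.+ m ℕ.* weight (crossing ℓ) g)
          ≡⟨ cong (λ z → p ℕ.* (C′ ℕ.+ z)) (weight-*ˡ (crossing ℓ) m g) ⟨
        p ℕ.* (C′ ℕ.+ weight (crossing ℓ) (λ e → m ℕ.* g e))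
          ≡⟨ cong (p ℕ.*_) (weight-+ (crossing ℓ) _ _) ⟨
        p ℕ.* weight (crossing ℓ) (λ e → g e ℕ.* w′ e ℕ.+ m ℕ.* g e)
          ≤⟨ ℕ.*-monoʳ-≤ p (sum-mono reassemble) ⟩
        p ℕ.* weight (crossing ℓ) (λ e → g e ℕ.* w e) ∎)
      where
      open ℕ.≤-Reasoning
      n = order
      p = pred order
      m = w e₀
      w′ : Edge G → ℕ
      w′ e = w e ℕ.∸ m
      W′ = weight F w′
      C′ = weight (crossing ℓ) (λ e → g e ℕ.* w′ e)

      arrange₁ : ∀ n N m W k → n ℕ.* N ℕ.* (m ℕ.+ (W ℕ.+ m ℕ.* k)) ≡ n ℕ.* N ℕ.* W ℕ.+ n ℕ.* suc k ℕ.* (N ℕ.* m)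
      arrange₁ = solve-∀
      arrange₂ : ∀ p C κ N m → p ℕ.* C ℕ.+ p ℕ.* κ ℕ.* (N ℕ.* m) ≡ p ℕ.* (C ℕ.+ m ℕ.* (κ ℕ.* N))
      arrange₂ = solve-∀

      restore : weight F w ℕ.≤ W′ ℕ.+ m ℕ.* k
      restore = begin
        weight F w
          ≤⟨ sum-mono (λ e → ℕ.*-monoʳ-≤ ⟦ lookup F e ⟧ (ℕ.≤-trans (ℕ.m≤n+m∸n (w e) m) (ℕ.≤-reflexive (ℕ.+-comm m (w′ e))))) ⟩
        weight F (λ e → w′ e ℕ.+ m)
          ≡⟨ weight-+ F w′ _ ⟩
        W′ ℕ.+ weight F (λ _ → m)
          ≡⟨ cong (W′ ℕ.+_) (trans (sum-cong-≗ {size} (λ e → cong (⟦ lookup F e ⟧ ℕ.*_) (sym (ℕ.*-identityʳ m))))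
                                    (weight-*ˡ F m (λ _ → 1))) ⟩
        W′ ℕ.+ m ℕ.* weight F (λ _ → 1)
          ≤⟨ ℕ.+-monoʳ-≤ W′ (ℕ.*-monoʳ-≤ m few) ⟩
        W′ ℕ.+ m ℕ.* k ∎

      -- Merging classes creates no new crossing edges, so the bound for the merged labelling may be
      -- taken over the old crossing set.
      crossing-⊆ : crossing (merge crosses ∘ ℓ) ⊆ crossing ℓ
      crossing-⊆ {e} e∈ = lookup⇒[]= e _ (trans (lookup∘tabulate _ e) (dec-true (crosses? ℓ e)
        λ eq → contradiction (cong (merge crosses) eq) (crossing⁻ e∈)))
        where
        crossing⁻ : e ∈ crossing (merge crosses ∘ ℓ) → merge crosses (ℓ (source G e)) ≢ merge crosses (ℓ (target G e))
        crossing⁻ e∈ eq with () ← trans (sym ([]=⇒lookup e∈))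
          (trans (lookup∘tabulate _ e) (dec-false (crosses? (merge crosses ∘ ℓ) e) (λ ne → ne eq)))

      -- On crossing edges the truncated subtraction is exact, because `e₀` is lightest among them;
      -- elsewhere the indicator is zero.
      reassemble : ∀ e → ⟦ lookup (crossing ℓ) e ⟧ ℕ.* (g e ℕ.* w′ e ℕ.+ m ℕ.* g e) ℕ.≤
                         ⟦ lookup (crossing ℓ) e ⟧ ℕ.* (g e ℕ.* w e)
      reassemble e rewrite lookup∘tabulate (does ∘ crosses? ℓ) e with ℓ (source G e) Fin.≟ ℓ (target G e)
      ... | yes _ = z≤n
      ... | no ne = ℕ.≤-reflexive (cong (1 ℕ.*_) (begin-equality
        g e ℕ.* w′ e ℕ.+ m ℕ.* g e   ≡⟨ cong (g e ℕ.* w′ e ℕ.+_) (ℕ.*-comm m (g e)) ⟩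
        g e ℕ.* w′ e ℕ.+ g e ℕ.* m   ≡⟨ ℕ.*-distribˡ-+ (g e) (w′ e) m ⟨
        g e ℕ.* (w′ e ℕ.+ m)         ≡⟨ cong (g e ℕ.*_) (ℕ.m∸n+n≡m (least e ne)) ⟩
        g e ℕ.* w e                  ∎))

      e₀∈ : e₀ ∈ ⁅ e₀ ⁆ ∪ F
      e₀∈ = Subset.p⊆p∪q F (Subset.x∈⁅x⁆ e₀)

      -- Two vertices that share a class only after the merge are linked through the ends of `e₀`.
      lift : ∀ {u v} → JoinedBy (merge crosses ∘ ℓ) F u v → Star (JoinedBy ℓ (⁅ e₀ ⁆ ∪ F)) u v
      lift (inj₂ adj) = return (inj₂ (adjacent-⊆ G (Subset.q⊆p∪q ⁅ e₀ ⁆ F) adj))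
      lift {u} {v} (inj₁ eq) with merge-kernel crosses (ℓ u) (ℓ v) eq
      ... | inj₁ same = return (inj₁ same)
      ... | inj₂ (inj₁ (u≡ , v≡)) = inj₁ u≡ ◅ inj₂ (e₀ , e₀∈ , inj₁ refl) ◅ return (inj₁ (sym v≡))
      ... | inj₂ (inj₂ (u≡ , v≡)) = inj₁ u≡ ◅ inj₂ (e₀ , e₀∈ , inj₂ refl) ◅ return (inj₁ (sym v≡))

    -- Each round picks a lightest crossing edge, merges its two classes and recurses with the
    -- weight of that edge subtracted throughout. With at most one class left, the empty edge set
    -- suffices.
    kruskal : ∀ κ (ℓ : Vertex G → Fin κ) → (∀ i → ∃[ v ] ℓ v ≡ i) → κ ℕ.≤ order →
              ∀ w → LightConnector κ ℓ w
    kruskal zero ℓ _ _ w = no-edges ℓ (λ u → case ℓ u of λ ()) w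
    kruskal (suc zero) ℓ _ _ w = no-edges ℓ (λ u v → one (ℓ u) (ℓ v)) w
      where
      one : (i j : Fin 1) → i ≡ j
      one zero zero = refl
    kruskal (suc (suc k)) ℓ onto κ≤n w =
      let e₀ , crosses , least = lightest-crossing ℓ onto (s≤s (s≤s z≤n)) w in
      contract k ℓ onto κ≤n w e₀ crosses least
        (kruskal (suc k) (merge crosses ∘ ℓ)
          (λ c → let v , eq = onto (punchIn _ c) in
                 v , trans (cong (merge crosses) eq) (merge-surjective crosses c))
          (ℕ.<⇒≤ κ≤n) (λ e → w e ℕ.∸ w e₀))

    module _ (s : ℕ) (total : sum g ℕ.≤ order ℕ.* N ℕ.+ s) where

      load : Vertex G → ℕ
      load v = ∑[ e < size ] (g e ℕ.* ends-at G v e)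

      -- The cuts around single vertices force every load to be at least `2 * N`. The loads add up
      -- to twice the mass of `g`, at most `2 * s` above the sum of these minima, so `excess-≤`
      -- applies.
      load-≤ : 2 ℕ.≤ order → ∀ v → load v ℕ.≤ 2 ℕ.* N ℕ.+ 2 ℕ.* s
      load-≤ 2≤n = excess-≤ load (2 ℕ.* N) (2 ℕ.* s)
        (λ v → ℕ.≤-trans (cut-class id (λ i → i , refl) 2≤n v) (sum-mono (at v)))
        (begin
          sum load
            ≡⟨ sum-cong-≗ {order} (λ v → ℕ.*-identityˡ (load v)) ⟨
          ∑[ v < order ] (1 ℕ.* load v)
            ≡⟨ handshake G (λ _ → 1) g ⟨
          ∑[ e < size ] (g e ℕ.* 2)
            ≡⟨ *-distribʳ-sum {size} 2 g ⟨
          sum g ℕ.* 2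
            ≤⟨ ℕ.*-monoˡ-≤ 2 total ⟩
          (order ℕ.* N ℕ.+ s) ℕ.* 2
            ≡⟨ arrange order N s ⟩
          order ℕ.* (2 ℕ.* N) ℕ.+ 2 ℕ.* s ∎)
        where
        open ℕ.≤-Reasoning
        arrange : ∀ n N s → (n ℕ.* N ℕ.+ s) ℕ.* 2 ≡ n ℕ.* (2 ℕ.* N) ℕ.+ 2 ℕ.* s
        arrange = solve-∀
        at : ∀ v e → ⟦ lookup (∂ G (class id v)) e ⟧ ℕ.* g e ℕ.≤ g e ℕ.* ends-at G v e
        at v e = ℕ.≤-trans
          (ℕ.*-monoˡ-≤ (g e) (ℕ.≤-trans (ℕ.≤-reflexive (cong ⟦_⟧ (lookup-∂class id v e)))
            (⟦xor⟧≤ (does (source G e Fin.≟ v)) (does (target G e Fin.≟ v)))))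
          (ℕ.≤-reflexive (ℕ.*-comm (ends-at G v e) (g e)))

      -- The main term contributes (2n - 2) N, and the slack condition lets the rounding error
      -- contribute at most one further `N`. For fewer than two vertices the factor `pred order`
      -- vanishes.
      pred*load-≤ : 2 ℕ.* pred order ℕ.* s ℕ.≤ N → ∀ v →
                    pred order ℕ.* load v ℕ.≤ (order ℕ.+ pred order) ℕ.* N
      pred*load-≤ slack v with 2 ℕ.≤? order
      ... | no 2≰n = subst (λ p → p ℕ.* load v ℕ.≤ (order ℕ.+ pred order) ℕ.* N)
                       (sym (ℕ.n≤0⇒n≡0 (ℕ.pred-mono-≤ (ℕ.≤-pred (ℕ.≰⇒> 2≰n))))) z≤n
      ... | yes 2≤n = begin
        p ℕ.* load v                             ≤⟨ ℕ.*-monoʳ-≤ p (load-≤ 2≤n v) ⟩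
        p ℕ.* (2 ℕ.* N ℕ.+ 2 ℕ.* s)              ≡⟨ arrange p N s ⟩
        2 ℕ.* p ℕ.* N ℕ.+ 2 ℕ.* p ℕ.* s          ≤⟨ ℕ.+-monoʳ-≤ (2 ℕ.* p ℕ.* N) slack ⟩
        2 ℕ.* p ℕ.* N ℕ.+ N                      ≡⟨ arrange′ p N ⟩
        (suc p ℕ.+ p) ℕ.* N                      ≡⟨ cong (λ n → (n ℕ.+ p) ℕ.* N) (ℕ.suc-pred order {{ℕ.>-nonZero (ℕ.<⇒≤ 2≤n)}}) ⟩
        (order ℕ.+ p) ℕ.* N                      ∎
        where
        open ℕ.≤-Reasoning
        p = pred order
        arrange : ∀ p N s → p ℕ.* (2 ℕ.* N ℕ.+ 2 ℕ.* s) ≡ 2 ℕ.* p ℕ.* N ℕ.+ 2 ℕ.* p ℕ.* s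
        arrange = solve-∀
        arrange′ : ∀ p N → 2 ℕ.* p ℕ.* N ℕ.+ N ≡ (suc p ℕ.+ p) ℕ.* N
        arrange′ = solve-∀

      -- Kruskal's algorithm starts from the labelling `id`, in which every vertex is its own class,
      -- and its output is pruned to a tree. The handshake identity rewrites the `g`-cost as a sum
      -- of `k v` times `load v`, to which the load bound applies vertex by vertex.
      cheapSpanningTree : 2 ℕ.* pred order ℕ.* s ℕ.≤ N → ∀ k → ∃[ T ] IsSpanningTree G T ×
        order ℕ.* weight T (endpointSum G k) ℕ.≤ (order ℕ.+ pred order) ℕ.* sum k
      cheapSpanningTree slack k
        with F , _ , conn , light ← kruskal order id (λ i → i , refl) ℕ.≤-refl (endpointSum G k)
        with T , T⊆F , tree ← connects⇒spanningTree G ∣ F ∣ F ℕ.≤-refl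
               (λ u v → kleisliStar id Sum.[ (λ { refl → ε }) , return ] (conn u v)) =
        T , tree , ℕ.*-cancelˡ-≤ N (begin
          N ℕ.* (order ℕ.* weight T c)
            ≤⟨ ℕ.*-monoʳ-≤ N (ℕ.*-monoʳ-≤ order (weight-⊆ c T⊆F)) ⟩
          N ℕ.* (order ℕ.* weight F c)
            ≡⟨ arrange N order (weight F c) ⟩
          order ℕ.* N ℕ.* weight F c
            ≤⟨ light ⟩
          p ℕ.* weight (crossing id) (λ e → g e ℕ.* c e)
            ≤⟨ ℕ.*-monoʳ-≤ p (sum-mono (λ e → ℕ.≤-trans (ℕ.*-monoˡ-≤ (g e ℕ.* c e) (⟦⟧≤1 (lookup (crossing id) e)))
                                                          (ℕ.≤-reflexive (ℕ.*-identityˡ _)))) ⟩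
          p ℕ.* ∑[ e < size ] (g e ℕ.* c e)
            ≡⟨ cong (p ℕ.*_) (handshake G k g) ⟩
          p ℕ.* ∑[ v < order ] (k v ℕ.* load v)
            ≡⟨ *-distribˡ-sum {order} p _ ⟩
          ∑[ v < order ] (p ℕ.* (k v ℕ.* load v))
            ≡⟨ sum-cong-≗ {order} (λ v → swap p (k v) (load v)) ⟩
          ∑[ v < order ] (k v ℕ.* (p ℕ.* load v))
            ≤⟨ sum-mono (λ v → ℕ.*-monoʳ-≤ (k v) (pred*load-≤ slack v)) ⟩
          ∑[ v < order ] (k v ℕ.* ((order ℕ.+ p) ℕ.* N))
            ≡⟨ *-distribʳ-sum {order} ((order ℕ.+ p) ℕ.* N) k ⟨
          sum k ℕ.* ((order ℕ.+ p) ℕ.* N)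
            ≡⟨ arrange′ (sum k) (order ℕ.+ p) N ⟩
          N ℕ.* ((order ℕ.+ p) ℕ.* sum k) ∎)
        where
        open ℕ.≤-Reasoning
        p = pred order
        c = endpointSum G k
        arrange : ∀ N n W → N ℕ.* (n ℕ.* W) ≡ n ℕ.* N ℕ.* W
        arrange = solve-∀
        arrange′ : ∀ K m N → K ℕ.* (m ℕ.* N) ≡ N ℕ.* (m ℕ.* K)
        arrange′ = solve-∀
        swap : ∀ x y z → x ℕ.* (y ℕ.* z) ≡ y ℕ.* (x ℕ.* z)
        swap = solve-∀

-- Integral approximation of a real fractional Hamiltonian cycle

opaque
  ι : ℕ → ℚ
  ι n = + n ℚ./ 1

  ι-zero : ι 0 ≡ 0ℚ
  ι-zero = refl

  ι-one : ι 1 ≡ 1ℚ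
  ι-one = refl

  ι-def : ∀ n → + n ℚ./ 1 ≡ ι n
  ι-def n = refl

  ι-suc : ∀ n → ι (suc n) ≡ 1ℚ ℚ.+ ι n
  ι-suc n = ℚ.toℚᵘ-injective (begin
    ℚ.toℚᵘ (ι (suc n))                   ≈⟨ ℚ.toℚᵘ-fromℚᵘ (ℚᵘ.mkℚᵘ (+ suc n) 0) ⟩
    ℚᵘ.mkℚᵘ (+ suc n) 0                  ≈⟨ ℚᵘ.*≡* (cong (ℤ._* + 1) (cong (λ z → + 1 ℤ.+ z) (sym (ℤ.*-identityʳ (+ n))))) ⟩
    ℚᵘ.1ℚᵘ ℚᵘ.+ ℚᵘ.mkℚᵘ (+ n) 0          ≈⟨ ℚᵘ.+-congʳ ℚᵘ.1ℚᵘ (ℚ.toℚᵘ-fromℚᵘ (ℚᵘ.mkℚᵘ (+ n) 0)) ⟨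
    ℚᵘ.1ℚᵘ ℚᵘ.+ ℚ.toℚᵘ (ι n)             ≈⟨ ℚ.toℚᵘ-homo-+ 1ℚ (ι n) ⟨
    ℚ.toℚᵘ (1ℚ ℚ.+ ι n)                  ∎)
    where open ℚᵘ.≃-Reasoning

  0≤ι : ∀ n → 0ℚ ℚ.≤ ι n
  0≤ι n = ℚ.nonNegative⁻¹ (ι n) {{ℚ.normalize-nonNeg n 1}}

  0<ι : ∀ n .{{_ : NonZero n}} → 0ℚ ℚ.< ι n
  0<ι n = ℚ.positive⁻¹ (ι n) {{ℚ.normalize-pos n 1}}

  archimedean : ∀ p → ∃[ n ] p ℚ.≤ ι n
  archimedean p@(ℚ.mkℚ num d-1 _) = ℤ.∣ num ∣ , ℚ.toℚᵘ-cancel-≤ (begin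
    ℚ.toℚᵘ p                      ≤⟨ ℚᵘ.*≤* bound ⟩
    ℚᵘ.mkℚᵘ (+ ℤ.∣ num ∣) 0       ≃⟨ ℚ.toℚᵘ-fromℚᵘ (ℚᵘ.mkℚᵘ (+ ℤ.∣ num ∣) 0) ⟨
    ℚ.toℚᵘ (ι ℤ.∣ num ∣)          ∎)
    where
    open ℚᵘ.≤-Reasoning
    i≤∣i∣ : ∀ i → i ℤ.≤ + ℤ.∣ i ∣
    i≤∣i∣ (+ n) = ℤ.≤-refl
    i≤∣i∣ (ℤ.-[1+ n ]) = ℤ.-≤+
    bound : num ℤ.* + 1 ℤ.≤ + ℤ.∣ num ∣ ℤ.* + suc d-1
    bound = ℤ.≤-trans (ℤ.≤-reflexive (ℤ.*-identityʳ num)) (ℤ.≤-trans (i≤∣i∣ num)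
      (ℤ.≤-trans (ℤ.+≤+ (ℕ.m≤m*n ℤ.∣ num ∣ (suc d-1))) (ℤ.≤-reflexive (ℤ.pos-* ℤ.∣ num ∣ (suc d-1)))))

ι-+ : ∀ m n → ι (m ℕ.+ n) ≡ ι m ℚ.+ ι n
ι-+ zero    n = sym (trans (cong (ℚ._+ ι n) ι-zero) (ℚ.+-identityˡ (ι n)))
ι-+ (suc m) n = begin
  ι (suc (m ℕ.+ n))             ≡⟨ ι-suc (m ℕ.+ n) ⟩
  1ℚ ℚ.+ ι (m ℕ.+ n)            ≡⟨ cong (1ℚ ℚ.+_) (ι-+ m n) ⟩
  1ℚ ℚ.+ (ι m ℚ.+ ι n)          ≡⟨ ℚ.+-assoc 1ℚ (ι m) (ι n) ⟨
  1ℚ ℚ.+ ι m ℚ.+ ι n            ≡⟨ cong (ℚ._+ ι n) (ι-suc m) ⟨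
  ι (suc m) ℚ.+ ι n             ∎
  where open ≡-Reasoning

ι-* : ∀ m n → ι (m ℕ.* n) ≡ ι m ℚ.* ι n
ι-* zero    n = trans ι-zero (sym (trans (cong (ℚ._* ι n) ι-zero) (ℚ.*-zeroˡ (ι n))))
ι-* (suc m) n = begin
  ι (n ℕ.+ m ℕ.* n)             ≡⟨ ι-+ n (m ℕ.* n) ⟩
  ι n ℚ.+ ι (m ℕ.* n)           ≡⟨ cong₂ ℚ._+_ (sym (ℚ.*-identityˡ (ι n))) (ι-* m n) ⟩
  1ℚ ℚ.* ι n ℚ.+ ι m ℚ.* ι n    ≡⟨ ℚ.*-distribʳ-+ (ι n) 1ℚ (ι m) ⟨
  (1ℚ ℚ.+ ι m) ℚ.* ι n          ≡⟨ cong (ℚ._* ι n) (ι-suc m) ⟨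
  ι (suc m) ℚ.* ι n             ∎
  where open ≡-Reasoning

ι-mono : ∀ {m n} → m ℕ.≤ n → ι m ℚ.≤ ι n
ι-mono {n = n} z≤n = ℚ.≤-trans (ℚ.≤-reflexive ι-zero) (0≤ι n)
ι-mono {suc m} {suc n} (s≤s m≤n) = subst₂ ℚ._≤_ (sym (ι-suc m)) (sym (ι-suc n)) (ℚ.+-monoʳ-≤ 1ℚ (ι-mono m≤n))

-- Integrality: an inequality between naturals that holds up to an error below 1 holds exactly.
ι<1+ι⇒≤ : ∀ {m n} → ι m ℚ.< 1ℚ ℚ.+ ι n → m ℕ.≤ n
ι<1+ι⇒≤ {m} {n} lt with m ℕ.≤? n
... | yes m≤n = m≤n
... | no m≰n  = contradiction
  (ℚ.<-≤-trans lt (ℚ.≤-trans (ℚ.≤-reflexive (sym (ι-suc n))) (ι-mono (ℕ.≰⇒> m≰n)))) (ℚ.<-irrefl refl)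

ceiling : ∀ y → 0ℚ ℚ.≤ y ℚ.+ 1ℚ → ∃[ n ] y ℚ.≤ ι n × ι n ℚ.≤ y ℚ.+ 1ℚ
ceiling y 0≤y+1 with M , y≤M ← archimedean y = search M y≤M
  where
  search : ∀ M → y ℚ.≤ ι M → ∃[ n ] y ℚ.≤ ι n × ι n ℚ.≤ y ℚ.+ 1ℚ
  -- The target may be negative; 0 is then still within 1 of it, by the hypothesis on `y + 1`.
  search zero    y≤0 = 0 , y≤0 , ℚ.≤-trans (ℚ.≤-reflexive ι-zero) 0≤y+1
  search (suc M) y≤M+1 with y ℚ.≤? ι M
  ... | yes y≤M = search M y≤M
  ... | no y≰M  = suc M , y≤M+1 , (begin
    ι (suc M)      ≡⟨ ι-suc M ⟩
    1ℚ ℚ.+ ι M     ≤⟨ ℚ.+-monoʳ-≤ 1ℚ (ℚ.<⇒≤ (ℚ.≰⇒> y≰M)) ⟩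
    1ℚ ℚ.+ y       ≡⟨ ℚ.+-comm 1ℚ y ⟩
    y ℚ.+ 1ℚ       ∎)
    where open ℚ.≤-Reasoning

-- Rational sums over edge sets and the terms of real sums.

ℚΣ-mono : ∀ {n} {f g : Fin n → ℚ} → (∀ i → f i ℚ.≤ g i) → ℚΣ.sum f ℚ.≤ ℚΣ.sum g
ℚΣ-mono {zero}  f≤g = ℚ.≤-refl
ℚΣ-mono {suc n} f≤g = ℚ.+-mono-≤ (f≤g zero) (ℚΣ-mono (f≤g ∘ suc))

ι-sum : ∀ {n} (f : Fin n → ℕ) → ι (sum f) ≡ ℚΣ.sum (ι ∘ f)
ι-sum {zero}  f = ι-zero
ι-sum {suc n} f = trans (ι-+ (f zero) _) (cong (ι (f zero) ℚ.+_) (ι-sum (f ∘ suc)))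

ℚ-weight : ∀ {m} → Subset m → (Fin m → ℚ) → ℚ
ℚ-weight F x = ℚΣ.sum (λ e → if lookup F e then x e else 0ℚ)

ι-weight : ∀ {m} (F : Subset m) g → ι (weight F g) ≡ ℚ-weight F (ι ∘ g)
ι-weight {m} F g = trans (ι-sum {m} (λ e → ⟦ lookup F e ⟧ ℕ.* g e)) (ℚΣ.sum-cong-≗ {m} λ e → choose (lookup F e) (g e))
  where
  choose : ∀ b n → ι (⟦ b ⟧ ℕ.* n) ≡ (if b then ι n else 0ℚ)
  choose false n = ι-zero
  choose true  n = cong ι (ℕ.+-identityʳ n)

ℚ-weight-mono : ∀ {m} (F : Subset m) {x y : Fin m → ℚ} → (∀ e → x e ℚ.≤ y e) → ℚ-weight F x ℚ.≤ ℚ-weight F y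
ℚ-weight-mono F x≤y = ℚΣ-mono λ e → choose (lookup F e) (x≤y e)
  where
  choose : ∀ b {p q} → p ℚ.≤ q → (if b then p else 0ℚ) ℚ.≤ (if b then q else 0ℚ)
  choose false _   = ℚ.≤-refl
  choose true  p≤q = p≤q

ℚ-weight-*ˡ : ∀ {m} (F : Subset m) a (x : Fin m → ℚ) → ℚ-weight F (λ e → a ℚ.* x e) ≡ a ℚ.* ℚ-weight F x
ℚ-weight-*ˡ {m} F a x = sym (trans (ℚΣ.*-distribˡ-sum {m} a _) (ℚΣ.sum-cong-≗ {m} λ e → choose (lookup F e) (x e)))
  where
  choose : ∀ b p → a ℚ.* (if b then p else 0ℚ) ≡ (if b then a ℚ.* p else 0ℚ)
  choose false p = ℚ.*-zeroʳ a
  choose true  p = refl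

ℚ-weight-⊤ : ∀ {m} (x : Fin m → ℚ) → ℚ-weight ⊤ x ≡ ℚΣ.sum x
ℚ-weight-⊤ {m} x = ℚΣ.sum-cong-≗ {m} λ e → cong (λ b → if b then x e else 0ℚ) (lookup-replicate e true)

seq-sum : ∀ {m} (f : Fin m → ℝ) i → seq (MonoidSum.sum +-rawMonoid f) i ≡ ℚΣ.sum (λ e → seq (f e) i)
seq-sum {zero}  f i = refl
seq-sum {suc m} f i = cong (seq (f zero) i ℚ.+_) (seq-sum (f ∘ suc) i)

seq-sumOver : ∀ {m} (F : Subset m) f i → seq (sumOver F f) i ≡ ℚ-weight F (λ e → seq (f e) i)
seq-sumOver {m} F f i = trans (seq-sum {m} (λ e → if lookup F e then f e else 0ℝ) i) (ℚΣ.sum-cong-≗ {m} λ e → choose (lookup F e) (f e))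
  where
  choose : ∀ b (x : ℝ) → seq (if b then x else 0ℝ) i ≡ (if b then seq x i else 0ℚ)
  choose false x = refl
  choose true  x = refl

-- Properties holding from some index on.

Eventually : (ℕ → Set) → Set
Eventually P = ∃[ N ] ∀ {i} → N ℕ.≤ i → P i

eventually-× : ∀ {P Q} → Eventually P → Eventually Q → Eventually (λ i → P i × Q i)
eventually-× (M , p) (N , q) = M ℕ.⊔ N , λ le → p (ℕ.m⊔n≤o⇒m≤o M N le) , q (ℕ.m⊔n≤o⇒n≤o M N le)

eventually-map : ∀ {P Q} → (∀ {i} → P i → Q i) → Eventually P → Eventually Q
eventually-map f (N , p) = N , f ∘ p

eventually-Fin : ∀ {n} {P : Fin n → ℕ → Set} → (∀ j → Eventually (P j)) → Eventually (λ i → ∀ j → P j i)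
eventually-Fin {zero}  h = 0 , λ _ ()
eventually-Fin {suc n} h = eventually-map (λ { (p , q) zero → p ; (p , q) (suc j) → q j })
  (eventually-× (h zero) (eventually-Fin (h ∘ suc)))

eventually-Subset : ∀ {n} {P : Subset n → ℕ → Set} → (∀ S → Eventually (P S)) → Eventually (λ i → ∀ S → P S i)
eventually-Subset {zero}  h = eventually-map (λ { p [] → p }) (h [])
eventually-Subset {suc n} h = eventually-map (λ { (p , q) (outside ∷ S) → p S ; (p , q) (inside ∷ S) → q S })
  (eventually-× (eventually-Subset (h ∘ (outside ∷_))) (eventually-Subset (h ∘ (inside ∷_))))

-- The threshold index has to be produced before a proof of `A` is given, so `A` must be decided
-- first.
eventually-→ : ∀ {A : Set} {P} → Dec A → (A → Eventually P) → Eventually (λ i → A → P i)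
eventually-→ (yes a) h = eventually-map (λ p _ → p) (h a)
eventually-→ (no ¬a) h = 0 , λ _ a → contradiction a ¬a

≤+∣-∣ : ∀ p q {δ} → ℚ.∣ p ℚ.- q ∣ ℚ.< δ → p ℚ.≤ q ℚ.+ δ
≤+∣-∣ p q {δ} close = begin
  p                            ≡⟨ p-q+q p q ⟨
  (p ℚ.- q) ℚ.+ q              ≤⟨ ℚ.+-monoˡ-≤ q (≤∣∣ (p ℚ.- q)) ⟩
  ℚ.∣ p ℚ.- q ∣ ℚ.+ q          ≤⟨ ℚ.+-monoˡ-≤ q (ℚ.<⇒≤ close) ⟩
  δ ℚ.+ q                      ≡⟨ ℚ.+-comm δ q ⟩
  q ℚ.+ δ                      ∎
  where
  open ℚ.≤-Reasoning
  ≤∣∣ : ∀ x → x ℚ.≤ ℚ.∣ x ∣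
  ≤∣∣ x with ℚ.≤-total 0ℚ x
  ... | inj₁ 0≤x = ℚ.≤-reflexive (sym (ℚ.0≤p⇒∣p∣≡p 0≤x))
  ... | inj₂ x≤0 = ℚ.≤-trans x≤0 (ℚ.0≤∣p∣ x)

module _ (G : Graph) (f : Edge G → ℝ) (ham : IsFractionalHamiltonianCycle G f) where
  open Graph G

  -- There are finitely many conditions, one per edge, one for the total and one per vertex set, so
  -- they all hold up to `δ` at a common index. The values of `f` at that index form `x`.
  rational-approximation : ∀ δ → 0ℚ ℚ.< δ → ∃[ x ]
    (∀ e → 0ℚ ℚ.≤ x e ℚ.+ δ) ×
    (ℚΣ.sum x ℚ.≤ ι order ℚ.+ δ) ×
    (∀ S → Nonempty S → S ⊂ ⊤ → ι 2 ℚ.≤ ℚ-weight (∂ G S) x ℚ.+ δ)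
  rational-approximation δ 0<δ =
    let i , h = eventually
        a , b , c = h ℕ.≤-refl
    in (λ e → seq (f e) i) , a ,
       subst (ℚ._≤ ι order ℚ.+ δ) (trans (seq-sumOver ⊤ f i) (ℚ-weight-⊤ {size} (λ e → seq (f e) i)))
         (≤+∣-∣ _ (ι order) (subst (λ q → ℚ.∣ seq (sumOver ⊤ f) i ℚ.- q ∣ ℚ.< δ) (ι-def order) b)) ,
       λ S ne pr → subst₂ (λ p q → p ℚ.≤ q ℚ.+ δ) (ι-def 2) (seq-sumOver (∂ G S) f i) (c S ne pr)
    where
    eventually : Eventually λ i →
      (∀ e → 0ℚ ℚ.≤ seq (f e) i ℚ.+ δ) ×
      (ℚ.∣ seq (sumOver ⊤ f) i ℚ.- + order ℚ./ 1 ∣ ℚ.< δ) ×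
      (∀ S → Nonempty S → S ⊂ ⊤ → + 2 ℚ./ 1 ℚ.≤ seq (sumOver (∂ G S) f) i ℚ.+ δ)
    eventually = eventually-×
      (eventually-Fin λ e → proj₁ (proj₁ ham e) δ 0<δ)
      (eventually-× (proj₁ (proj₂ ham) δ 0<δ)
        (eventually-Subset λ S → eventually-→ (nonempty? S) λ ne → eventually-→ (S ⊂? ⊤) λ pr →
          proj₂ (proj₂ ham) S ne pr δ 0<δ))

  -- Rounding up N x keeps the cut condition exactly, since both of its sides are integers.
  module Rounding (N : ℕ) (δ : ℚ) (Nδ≡½ : ι N ℚ.* δ ≡ ½) (x : Edge G → ℚ)
    (x≥ : ∀ e → 0ℚ ℚ.≤ x e ℚ.+ δ)
    (x-total : ℚΣ.sum x ℚ.≤ ι order ℚ.+ δ)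
    (x-cut : ∀ S → Nonempty S → S ⊂ ⊤ → ι 2 ℚ.≤ ℚ-weight (∂ G S) x ℚ.+ δ) where
    open ℚ.≤-Reasoning
    scale : ∀ {p q} → p ℚ.≤ q → ι N ℚ.* p ℚ.≤ ι N ℚ.* q
    scale = ℚ.*-monoˡ-≤-nonNeg (ι N) {{ℚ.nonNegative (0≤ι N)}}

    -- Here `δ` is 1 / (2N), so after scaling the error is one half, small enough for integrality to
    -- absorb.
    scale-δ : ∀ p → ι N ℚ.* (p ℚ.+ δ) ≡ ι N ℚ.* p ℚ.+ ½
    scale-δ p = trans (ℚ.*-distribˡ-+ (ι N) p δ) (cong (ι N ℚ.* p ℚ.+_) Nδ≡½)

    ½≤1 : ½ ℚ.≤ 1ℚ
    ½≤1 = ℚ.≤ᵇ⇒≤ _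
    ½<1 : ½ ℚ.< 1ℚ
    ½<1 = ℚ.≰⇒> λ h → case ℚ.≤⇒≤ᵇ h of λ ()

    rounded : ∀ e → ∃[ n ] ι N ℚ.* x e ℚ.≤ ι n × ι n ℚ.≤ ι N ℚ.* x e ℚ.+ 1ℚ
    rounded e = ceiling (ι N ℚ.* x e) (begin
      0ℚ                        ≡⟨ ℚ.*-zeroʳ (ι N) ⟨
      ι N ℚ.* 0ℚ                ≤⟨ scale (x≥ e) ⟩
      ι N ℚ.* (x e ℚ.+ δ)       ≡⟨ scale-δ (x e) ⟩
      ι N ℚ.* x e ℚ.+ ½         ≤⟨ ℚ.+-monoʳ-≤ (ι N ℚ.* x e) ½≤1 ⟩
      ι N ℚ.* x e ℚ.+ 1ℚ        ∎)

    g : Edge G → ℕ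
    g e = proj₁ (rounded e)

    g-cut : ∀ S → Nonempty S → S ⊂ ⊤ → 2 ℕ.* N ℕ.≤ weight (∂ G S) g
    g-cut S ne pr = ι<1+ι⇒≤ (begin-strict
      ι (2 ℕ.* N)                               ≡⟨ trans (ι-* 2 N) (ℚ.*-comm (ι 2) (ι N)) ⟩
      ι N ℚ.* ι 2                               ≤⟨ scale (x-cut S ne pr) ⟩
      ι N ℚ.* (ℚ-weight (∂ G S) x ℚ.+ δ)        ≡⟨ scale-δ _ ⟩
      ι N ℚ.* ℚ-weight (∂ G S) x ℚ.+ ½          ≡⟨ cong (ℚ._+ ½) (ℚ-weight-*ˡ (∂ G S) (ι N) x) ⟨
      ℚ-weight (∂ G S) (λ e → ι N ℚ.* x e) ℚ.+ ½
        ≤⟨ ℚ.+-monoˡ-≤ ½ (ℚ-weight-mono (∂ G S) (λ e → proj₁ (proj₂ (rounded e)))) ⟩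
      ℚ-weight (∂ G S) (ι ∘ g) ℚ.+ ½            ≡⟨ cong (ℚ._+ ½) (ι-weight (∂ G S) g) ⟨
      ι (weight (∂ G S) g) ℚ.+ ½                <⟨ ℚ.+-monoʳ-< (ι (weight (∂ G S) g)) ½<1 ⟩
      ι (weight (∂ G S) g) ℚ.+ 1ℚ               ≡⟨ ℚ.+-comm (ι (weight (∂ G S) g)) 1ℚ ⟩
      1ℚ ℚ.+ ι (weight (∂ G S) g)               ∎)

    ones : ℚΣ.sum {size} (λ _ → 1ℚ) ≡ ι size
    ones = trans (ℚΣ.sum-cong-≗ {size} λ _ → sym ι-one) (trans (sym (ι-sum {size} (λ _ → 1))) (cong ι (trans (sum-const size 1) (ℕ.*-identityʳ size))))

    -- Rounding up costs at most 1 per edge, and the scaled approximation error of one half costs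
    -- less than 1 more, whence `suc size`.
    g-total : sum g ℕ.≤ order ℕ.* N ℕ.+ suc size
    g-total = ι<1+ι⇒≤ (begin-strict
      ι (sum g)                                   ≡⟨ ι-sum g ⟩
      ℚΣ.sum (ι ∘ g)                              ≤⟨ ℚΣ-mono (λ e → proj₂ (proj₂ (rounded e))) ⟩
      ℚΣ.sum (λ e → ι N ℚ.* x e ℚ.+ 1ℚ)           ≡⟨ ℚΣ.∑-distrib-+ {size} _ _ ⟩
      ℚΣ.sum (λ e → ι N ℚ.* x e) ℚ.+ ℚΣ.sum {size} (λ _ → 1ℚ)
        ≡⟨ cong₂ ℚ._+_ (sym (ℚΣ.*-distribˡ-sum {size} (ι N) x)) ones ⟩
      ι N ℚ.* ℚΣ.sum x ℚ.+ ι size                 ≤⟨ ℚ.+-monoˡ-≤ (ι size) (scale x-total) ⟩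
      ι N ℚ.* (ι order ℚ.+ δ) ℚ.+ ι size          ≡⟨ cong (ℚ._+ ι size) (scale-δ (ι order)) ⟩
      ι N ℚ.* ι order ℚ.+ ½ ℚ.+ ι size            ≡⟨ cong (λ z → z ℚ.+ ½ ℚ.+ ι size) (trans (ℚ.*-comm (ι N) (ι order)) (sym (ι-* order N))) ⟩
      ι (order ℕ.* N) ℚ.+ ½ ℚ.+ ι size            <⟨ ℚ.+-monoˡ-< (ι size) (ℚ.+-monoʳ-< (ι (order ℕ.* N)) ½<1) ⟩
      ι (order ℕ.* N) ℚ.+ 1ℚ ℚ.+ ι size           ≡⟨ ℚ.+-assoc (ι (order ℕ.* N)) 1ℚ (ι size) ⟩
      ι (order ℕ.* N) ℚ.+ (1ℚ ℚ.+ ι size)         ≡⟨ cong (ι (order ℕ.* N) ℚ.+_) (ι-suc size) ⟨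
      ι (order ℕ.* N) ℚ.+ ι (suc size)            ≡⟨ ι-+ (order ℕ.* N) (suc size) ⟨
      ι (order ℕ.* N ℕ.+ suc size)                ≡⟨ ℚ.+-identityˡ _ ⟨
      0ℚ ℚ.+ ι (order ℕ.* N ℕ.+ suc size)         <⟨ ℚ.+-monoˡ-< (ι (order ℕ.* N ℕ.+ suc size)) 0<1 ⟩
      1ℚ ℚ.+ ι (order ℕ.* N ℕ.+ suc size)         ∎)

  integral-approximation : ∀ N .{{_ : NonZero N}} → ∃[ g ]
    (∀ S → Nonempty S → S ⊂ ⊤ → 2 ℕ.* N ℕ.≤ weight (∂ G S) g) ×
    sum g ℕ.≤ order ℕ.* N ℕ.+ suc size
  integral-approximation N =
    let δ , 0<δ , Nδ≡½ = shrink (ι N) ½ (0<ι N) 0<½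
        x , x≥ , x-total , x-cut = rational-approximation δ 0<δ
        open Rounding N δ Nδ≡½ x x≥ x-total x-cut
    in g , g-cut , g-total

-- Descent on the tree sum

0≤1 : 0ℚ ℚ.≤ 1ℚ
0≤1 = ℚ.<⇒≤ 0<1

0≤* : ∀ {p q} → 0ℚ ℚ.≤ p → 0ℚ ℚ.≤ q → 0ℚ ℚ.≤ p ℚ.* q
0≤* {p} {q} 0≤p 0≤q = ℚ.nonNegative⁻¹ _
  {{ℚ.nonNeg*nonNeg⇒nonNeg p {{ℚ.nonNegative 0≤p}} q {{ℚ.nonNegative 0≤q}}}}

0≤+ : ∀ {p q} → 0ℚ ℚ.≤ p → 0ℚ ℚ.≤ q → 0ℚ ℚ.≤ p ℚ.+ q
0≤+ = ℚ.+-mono-≤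

*-monoˡ : ∀ {p q r} → 0ℚ ℚ.≤ r → p ℚ.≤ q → r ℚ.* p ℚ.≤ r ℚ.* q
*-monoˡ {r = r} 0≤r = ℚ.*-monoˡ-≤-nonNeg r {{ℚ.nonNegative 0≤r}}

*-monoʳ : ∀ {p q r} → 0ℚ ℚ.≤ r → p ℚ.≤ q → p ℚ.* r ℚ.≤ q ℚ.* r
*-monoʳ {r = r} 0≤r = ℚ.*-monoʳ-≤-nonNeg r {{ℚ.nonNegative 0≤r}}

-- Reduces a polynomial inequality to a ring identity with an explicit nonnegative remainder `s`.
+-slack : ∀ {p q s} → 0ℚ ℚ.≤ s → p ℚ.+ s ≡ q → p ℚ.≤ q
+-slack {p} {q} {s} 0≤s eq = begin
  p           ≡⟨ ℚ.+-identityʳ p ⟨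
  p ℚ.+ 0ℚ    ≤⟨ ℚ.+-monoʳ-≤ p 0≤s ⟩
  p ℚ.+ s     ≡⟨ eq ⟩
  q           ∎
  where open ℚ.≤-Reasoning

p<q⇒0<q-p : ∀ {p q} → p ℚ.< q → 0ℚ ℚ.< q ℚ.- p
p<q⇒0<q-p {p} {q} p<q = subst (ℚ._< q ℚ.- p) (ℚ.+-inverseʳ p) (ℚ.+-monoˡ-< (ℚ.- p) p<q)

0<^ : ∀ {q} n → 0ℚ ℚ.< q → 0ℚ ℚ.< q ^ n
0<^ zero    _   = 0<1
0<^ (suc n) 0<q = pos* 0<q (0<^ n 0<q)

^-≤1 : ∀ {q} n → 0ℚ ℚ.< q → q ℚ.≤ 1ℚ → q ^ n ℚ.≤ 1ℚ
^-≤1 zero _ _ = ℚ.≤-refl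
^-≤1 {q} (suc n) 0<q q≤1 = begin
  q ℚ.* q ^ n    ≤⟨ *-monoʳ (ℚ.<⇒≤ (0<^ n 0<q)) q≤1 ⟩
  1ℚ ℚ.* q ^ n   ≡⟨ ℚ.*-identityˡ (q ^ n) ⟩
  q ^ n          ≤⟨ ^-≤1 n 0<q q≤1 ⟩
  1ℚ             ∎
  where open ℚ.≤-Reasoning

^-antitone : ∀ {q m n} → 0ℚ ℚ.< q → q ℚ.≤ 1ℚ → m ℕ.≤ n → q ^ n ℚ.≤ q ^ m
^-antitone {n = n} 0<q q≤1 z≤n = ^-≤1 n 0<q q≤1
^-antitone 0<q q≤1 (s≤s m≤n) = *-monoˡ (ℚ.<⇒≤ 0<q) (^-antitone 0<q q≤1 m≤n)

-- Bernoulli's inequality; `h` may be negative, and `Y+h≤X` takes it to be `- δ`. The remainder of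
-- the induction step is n h².
bernoulli : ∀ {h} n → 0ℚ ℚ.≤ 1ℚ ℚ.+ h → 1ℚ ℚ.+ ι n ℚ.* h ℚ.≤ (1ℚ ℚ.+ h) ^ n
bernoulli {h} zero _ = ℚ.≤-reflexive
  (trans (cong (λ z → 1ℚ ℚ.+ z ℚ.* h) ι-zero) (trans (cong (1ℚ ℚ.+_) (ℚ.*-zeroˡ h)) (ℚ.+-identityʳ 1ℚ)))
bernoulli {h} (suc n) 0≤1+h = begin
  1ℚ ℚ.+ ι (suc n) ℚ.* h              ≡⟨ cong (λ z → 1ℚ ℚ.+ z ℚ.* h) (ι-suc n) ⟩
  1ℚ ℚ.+ (1ℚ ℚ.+ ι n) ℚ.* h           ≤⟨ +-slack (0≤* (0≤ι n) (square≥0 h)) (expand (ι n) h) ⟩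
  (1ℚ ℚ.+ h) ℚ.* (1ℚ ℚ.+ ι n ℚ.* h)   ≤⟨ *-monoˡ 0≤1+h (bernoulli n 0≤1+h) ⟩
  (1ℚ ℚ.+ h) ℚ.* (1ℚ ℚ.+ h) ^ n       ∎
  where
  open ℚ.≤-Reasoning
  expand : ∀ d h → 1ℚ ℚ.+ (1ℚ ℚ.+ d) ℚ.* h ℚ.+ d ℚ.* (h ℚ.* h) ≡ (1ℚ ℚ.+ h) ℚ.* (1ℚ ℚ.+ d ℚ.* h)
  expand = solve 2 (λ d h → con 1ℚ :+ (con 1ℚ :+ d) :* h :+ d :* (h :* h) :=
                            (con 1ℚ :+ h) :* (con 1ℚ :+ d :* h)) refl
    where open +-*-Solver
  square≥0 : ∀ x → 0ℚ ℚ.≤ x ℚ.* x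
  square≥0 x with ℚ.≤-total 0ℚ x
  ... | inj₁ 0≤x = 0≤* 0≤x 0≤x
  ... | inj₂ x≤0 = subst (0ℚ ℚ.≤_) (neg² x) (0≤* (ℚ.neg-antimono-≤ x≤0) (ℚ.neg-antimono-≤ x≤0))
    where
    neg² : ∀ x → ℚ.- x ℚ.* ℚ.- x ≡ x ℚ.* x
    neg² = solve 1 (λ x → :- x :* :- x := x :* x) refl
      where open +-*-Solver

-- A second-order upper bound. The generous coefficient n² in place of n (n - 1) / 2 keeps the
-- remainder of the induction step, (1 + n) δ² + n² δ³, visibly nonnegative.
bernoulli² : ∀ {δ} n → 0ℚ ℚ.≤ δ → 0ℚ ℚ.≤ 1ℚ ℚ.- δ →
             (1ℚ ℚ.- δ) ^ n ℚ.≤ 1ℚ ℚ.- ι n ℚ.* δ ℚ.+ (ι n ℚ.* ι n) ℚ.* (δ ℚ.* δ)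
bernoulli² {δ} zero 0≤δ _ = ℚ.≤-reflexive (sym (trans
  (cong (λ z → 1ℚ ℚ.- z ℚ.* δ ℚ.+ (z ℚ.* z) ℚ.* (δ ℚ.* δ)) ι-zero) (vanish δ)))
  where
  vanish : ∀ δ → 1ℚ ℚ.- 0ℚ ℚ.* δ ℚ.+ (0ℚ ℚ.* 0ℚ) ℚ.* (δ ℚ.* δ) ≡ 1ℚ
  vanish = solve 1 (λ δ → con 1ℚ :- con 0ℚ :* δ :+ (con 0ℚ :* con 0ℚ) :* (δ :* δ) := con 1ℚ) refl
    where open +-*-Solver
bernoulli² {δ} (suc n) 0≤δ 0≤1-δ = begin
  (1ℚ ℚ.- δ) ℚ.* (1ℚ ℚ.- δ) ^ n
    ≤⟨ *-monoˡ 0≤1-δ (bernoulli² n 0≤δ 0≤1-δ) ⟩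
  (1ℚ ℚ.- δ) ℚ.* (1ℚ ℚ.- d ℚ.* δ ℚ.+ (d ℚ.* d) ℚ.* (δ ℚ.* δ))
    ≤⟨ +-slack (0≤+ (0≤* (0≤+ 0≤1 (0≤ι n)) 0≤δ²) (0≤* (0≤* (0≤* (0≤ι n) (0≤ι n)) 0≤δ) 0≤δ²)) (expand d δ) ⟩
  1ℚ ℚ.- (1ℚ ℚ.+ d) ℚ.* δ ℚ.+ ((1ℚ ℚ.+ d) ℚ.* (1ℚ ℚ.+ d)) ℚ.* (δ ℚ.* δ)
    ≡⟨ cong (λ z → 1ℚ ℚ.- z ℚ.* δ ℚ.+ (z ℚ.* z) ℚ.* (δ ℚ.* δ)) (ι-suc n) ⟨
  1ℚ ℚ.- ι (suc n) ℚ.* δ ℚ.+ (ι (suc n) ℚ.* ι (suc n)) ℚ.* (δ ℚ.* δ) ∎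
  where
  open ℚ.≤-Reasoning
  d = ι n
  0≤δ² = 0≤* 0≤δ 0≤δ
  expand : ∀ d δ →
    (1ℚ ℚ.- δ) ℚ.* (1ℚ ℚ.- d ℚ.* δ ℚ.+ (d ℚ.* d) ℚ.* (δ ℚ.* δ)) ℚ.+
    ((1ℚ ℚ.+ d) ℚ.* (δ ℚ.* δ) ℚ.+ (d ℚ.* d ℚ.* δ) ℚ.* (δ ℚ.* δ)) ≡
    1ℚ ℚ.- (1ℚ ℚ.+ d) ℚ.* δ ℚ.+ ((1ℚ ℚ.+ d) ℚ.* (1ℚ ℚ.+ d)) ℚ.* (δ ℚ.* δ)
  expand = solve 2 (λ d δ →
    (con 1ℚ :- δ) :* (con 1ℚ :- d :* δ :+ (d :* d) :* (δ :* δ)) :+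
    ((con 1ℚ :+ d) :* (δ :* δ) :+ (d :* d :* δ) :* (δ :* δ)) :=
    con 1ℚ :- (con 1ℚ :+ d) :* δ :+ ((con 1ℚ :+ d) :* (con 1ℚ :+ d)) :* (δ :* δ)) refl
    where open +-*-Solver

-- Sums over lists of edge sets.

listSum : ∀ {A : Set} → (A → ℚ) → List A → ℚ
listSum φ xs = foldr ℚ._+_ 0ℚ (map φ xs)

module _ {A : Set} where

  listSum-mono : ∀ {φ ψ : A → ℚ} → (∀ x → φ x ℚ.≤ ψ x) → ∀ xs → listSum φ xs ℚ.≤ listSum ψ xs
  listSum-mono φ≤ψ []       = ℚ.≤-refl
  listSum-mono φ≤ψ (x ∷ xs) = ℚ.+-mono-≤ (φ≤ψ x) (listSum-mono φ≤ψ xs)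

  listSum-nonNeg : ∀ {φ : A → ℚ} → (∀ x → 0ℚ ℚ.≤ φ x) → ∀ xs → 0ℚ ℚ.≤ listSum φ xs
  listSum-nonNeg 0≤φ []       = ℚ.≤-refl
  listSum-nonNeg 0≤φ (x ∷ xs) = 0≤+ (0≤φ x) (listSum-nonNeg 0≤φ xs)

  term≤listSum : ∀ {φ : A → ℚ} → (∀ x → 0ℚ ℚ.≤ φ x) → ∀ {x xs} → x ∈ˡ xs → φ x ℚ.≤ listSum φ xs
  term≤listSum {φ} 0≤φ {x} {_ ∷ xs} (here refl) = +-slack (listSum-nonNeg 0≤φ xs) refl
  term≤listSum {φ} 0≤φ {x} {y ∷ xs} (there x∈)  = ℚ.≤-trans (term≤listSum 0≤φ x∈)
    (+-slack (0≤φ y) (ℚ.+-comm (listSum φ xs) (φ y)))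

  listSum-linear : ∀ a b (φ ψ : A → ℚ) xs →
    listSum (λ x → a ℚ.* φ x ℚ.+ b ℚ.* ψ x) xs ≡ a ℚ.* listSum φ xs ℚ.+ b ℚ.* listSum ψ xs
  listSum-linear a b φ ψ [] = sym (trans (cong₂ ℚ._+_ (ℚ.*-zeroʳ a) (ℚ.*-zeroʳ b)) (ℚ.+-identityʳ 0ℚ))
  listSum-linear a b φ ψ (x ∷ xs) = trans (cong (a ℚ.* φ x ℚ.+ b ℚ.* ψ x ℚ.+_) (listSum-linear a b φ ψ xs))
    (regroup a b (φ x) (ψ x) (listSum φ xs) (listSum ψ xs))
    where
    regroup : ∀ a b p q s t → a ℚ.* p ℚ.+ b ℚ.* q ℚ.+ (a ℚ.* s ℚ.+ b ℚ.* t) ≡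
                              a ℚ.* (p ℚ.+ s) ℚ.+ b ℚ.* (q ℚ.+ t)
    regroup = solve 6 (λ a b p q s t → a :* p :+ b :* q :+ (a :* s :+ b :* t) :=
                                       a :* (p :+ s) :+ b :* (q :+ t)) refl
      where open +-*-Solver

∈-allSubsets : ∀ {m} (S : Subset m) → S ∈ˡ allSubsets m
∈-allSubsets []            = here refl
∈-allSubsets (outside ∷ S) = ∈-++⁺ˡ (∈-map⁺ (outside ∷_) (∈-allSubsets S))
∈-allSubsets {suc m} (inside ∷ S) =
  ∈-++⁺ʳ (map (outside ∷_) (allSubsets m)) (∈-map⁺ (inside ∷_) (∈-allSubsets S))

≟-comm : ∀ {n} (i j : Fin n) → does (i Fin.≟ j) ≡ does (j Fin.≟ i)
≟-comm zero    zero    = refl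
≟-comm zero    (suc j) = refl
≟-comm (suc i) zero    = refl
≟-comm (suc i) (suc j) = ≟-comm i j

seq-weightSum : ∀ {G : Graph} (c : Edge G → ℝ) (φ : EdgeSet G → ℚ) i →
  (∀ T → seq (productOver T c) i ≡ φ T) → ∀ Ts → seq (weightSum G c Ts) i ≡ listSum φ Ts
seq-weightSum {G} c φ i eq []       = refl
seq-weightSum {G} c φ i eq (T ∷ Ts) = cong₂ ℚ._+_ (eq T) (seq-weightSum {G} c φ i eq Ts)

seq-product-^ : ∀ {m} q (b : Fin m → Bool) (a : Fin m → ℕ) i →
  seq (MonoidSum.sum *-rawMonoid (λ e → if b e then fromℚ (q ^ a e) else 1ℝ)) i ≡ q ^ ∑[ e < m ] (⟦ b e ⟧ ℕ.* a e)
seq-product-^ {zero}  q b a i = refl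
seq-product-^ {suc m} q b a i = trans (cong₂ ℚ._*_ (factor (b zero)) (seq-product-^ q (b ∘ suc) (a ∘ suc) i))
  (sym (Exp.^-homo-* q (⟦ b zero ⟧ ℕ.* a zero) (∑[ e < m ] (⟦ b (suc e) ⟧ ℕ.* a (suc e)))))
  where
  factor : ∀ b₀ → seq (if b₀ then fromℚ (q ^ a zero) else 1ℝ) i ≡ q ^ (⟦ b₀ ⟧ ℕ.* a zero)
  factor false = refl
  factor true  = cong (q ^_) (sym (ℕ.*-identityˡ (a zero)))

listSum-filter : ∀ {m} (φ : Subset m → ℚ) e T Ts →
  listSum φ (filter (e ∈?_) (T ∷ Ts)) ≡ (if lookup T e then φ T else 0ℚ) ℚ.+ listSum φ (filter (e ∈?_) Ts)
listSum-filter φ e T Ts with lookup T e in eq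
... | true  = cong (listSum φ) (filter-accept (e ∈?_) (lookup⇒[]= e T eq))
... | false = trans (cong (listSum φ) (filter-reject (e ∈?_) λ e∈T → case trans (sym eq) ([]=⇒lookup e∈T) of λ ()))
                    (sym (ℚ.+-identityˡ _))

ℚ-weight-0 : ∀ {m} (F : Subset m) → ℚ-weight F (λ _ → 0ℚ) ≡ 0ℚ
ℚ-weight-0 {m} F = trans (ℚΣ.sum-cong-≗ {m} λ e → choose (lookup F e)) (ℚΣ.sum-replicate-zero m)
  where
  choose : ∀ b → (if b then 0ℚ else 0ℚ) ≡ 0ℚ
  choose false = refl
  choose true  = refl

ℚ-weight-+ : ∀ {m} (F : Subset m) (x y : Fin m → ℚ) →
  ℚ-weight F (λ e → x e ℚ.+ y e) ≡ ℚ-weight F x ℚ.+ ℚ-weight F y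
ℚ-weight-+ {m} F x y = trans (ℚΣ.sum-cong-≗ {m} λ e → choose (lookup F e) (x e) (y e)) (ℚΣ.∑-distrib-+ {m} _ _)
  where
  choose : ∀ b p q → (if b then p ℚ.+ q else 0ℚ) ≡ (if b then p else 0ℚ) ℚ.+ (if b then q else 0ℚ)
  choose false p q = refl
  choose true  p q = refl

ℚΣ-*ʳ-ι : ∀ {m} (f : Fin m → ℕ) p → ℚΣ.sum (λ e → ι (f e) ℚ.* p) ≡ ι (sum f) ℚ.* p
ℚΣ-*ʳ-ι {m} f p = trans (sym (ℚΣ.*-distribʳ-sum {m} p (ι ∘ f))) (cong (ℚ._* p) (sym (ι-sum f)))

-- Double counting the pairs of an edge at v and a tree through it.
incidentSum-≤ : ∀ (G : Graph) v (φ : EdgeSet G → ℚ) → (∀ T → 0ℚ ℚ.≤ φ T) → ∀ Ts →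
  ℚ-weight (incident G v) (λ e → listSum φ (filter (e ∈?_) Ts)) ℚ.≤
  listSum (λ T → ι (weight T (ends-at G v)) ℚ.* φ T) Ts
incidentSum-≤ G v φ 0≤φ [] = ℚ.≤-reflexive (ℚ-weight-0 (incident G v))
incidentSum-≤ G v φ 0≤φ (T ∷ Ts) = begin
  ℚ-weight I (λ e → listSum φ (filter (e ∈?_) (T ∷ Ts)))
    ≡⟨ ℚΣ.sum-cong-≗ {size} (λ e → cong (λ z → if lookup I e then z else 0ℚ) (listSum-filter φ e T Ts)) ⟩
  ℚ-weight I (λ e → through e ℚ.+ listSum φ (filter (e ∈?_) Ts))
    ≡⟨ ℚ-weight-+ I through _ ⟩
  ℚ-weight I through ℚ.+ ℚ-weight I (λ e → listSum φ (filter (e ∈?_) Ts))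
    ≤⟨ ℚ.+-mono-≤ first (incidentSum-≤ G v φ 0≤φ Ts) ⟩
  ι (weight T (ends-at G v)) ℚ.* φ T ℚ.+ listSum (λ T → ι (weight T (ends-at G v)) ℚ.* φ T) Ts ∎
  where
  open Graph G
  open ℚ.≤-Reasoning
  I = incident G v
  through : Edge G → ℚ
  through e = if lookup T e then φ T else 0ℚ
  ⟦incident⟧≤ : ∀ e → ⟦ lookup I e ⟧ ℕ.≤ ends-at G v e
  ⟦incident⟧≤ e = ℕ.≤-trans (ℕ.≤-reflexive (cong ⟦_⟧ (lookup∘tabulate _ e)))
    (⟦∨⟧≤ (does (source G e Fin.≟ v)) (does (target G e Fin.≟ v)))
  bound : ∀ b t {d} → ⟦ b ⟧ ℕ.≤ d → (if b then (if t then φ T else 0ℚ) else 0ℚ) ℚ.≤ ι (⟦ t ⟧ ℕ.* d) ℚ.* φ T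
  bound false t     {d} _   = 0≤* (0≤ι (⟦ t ⟧ ℕ.* d)) (0≤φ T)
  bound true  false {d} _   = 0≤* (0≤ι 0) (0≤φ T)
  bound true  true  {d} 1≤d = begin
    φ T                     ≡⟨ ℚ.*-identityˡ (φ T) ⟨
    1ℚ ℚ.* φ T              ≡⟨ cong (ℚ._* φ T) ι-one ⟨
    ι 1 ℚ.* φ T             ≤⟨ *-monoʳ (0≤φ T) (ι-mono (ℕ.≤-trans 1≤d (ℕ.≤-reflexive (sym (ℕ.*-identityˡ d))))) ⟩
    ι (1 ℕ.* d) ℚ.* φ T     ∎
  first : ℚ-weight I through ℚ.≤ ι (weight T (ends-at G v)) ℚ.* φ T
  first = ℚ.≤-trans (ℚΣ-mono (λ e → bound (lookup I e) (lookup T e) (⟦incident⟧≤ e)))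
                    (ℚ.≤-reflexive (ℚΣ-*ʳ-ι (λ e → ⟦ lookup T e ⟧ ℕ.* ends-at G v e) (φ T)))

-- Incrementing the vertex potential until all expected degrees are below 2.

HasCheapTrees : Graph → Set
HasCheapTrees G = ∀ k → ∃[ T ] IsSpanningTree G T ×
  order ℕ.* weight T (endpointSum G k) ℕ.≤ (order ℕ.+ pred order) ℕ.* sum k
  where open Graph G

-- A crude bound on n deg_T(v), the exponent of `q` gained by a tree in one increment at `v`.
degreeBound : Graph → ℕ
degreeBound G = order ℕ.* (size ℕ.* 2)
  where open Graph G

module Descent (G : Graph) (order≢0 : NonZero (Graph.order G)) (cheap : HasCheapTrees G)
  (δ : ℚ) (0<δ : 0ℚ ℚ.< δ) (0<q : 0ℚ ℚ.< 1ℚ ℚ.- δ)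
  (δ-small : ι (degreeBound G) ℚ.* ι (degreeBound G) ℚ.* δ ℚ.< 1ℚ) where

  open Graph G

  n = order
  trees = spanningTrees G
  D = ι (degreeBound G)
  q = 1ℚ ℚ.- δ
  X = q ^ (order ℕ.+ pred order)
  -- One increment at a vertex of expected degree at least 2 multiplies τ by at most Y ≤ X / (1 + h).
  Y = 1ℚ ℚ.+ D ℚ.* D ℚ.* (δ ℚ.* δ) ℚ.- (ι n ℚ.* δ ℚ.+ ι n ℚ.* δ)
  h = δ ℚ.* (1ℚ ℚ.- D ℚ.* D ℚ.* δ)

  0≤δ : 0ℚ ℚ.≤ δ
  0≤δ = ℚ.<⇒≤ 0<δ

  q≤1 : q ℚ.≤ 1ℚ
  q≤1 = +-slack 0≤δ (p-q+q 1ℚ δ)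

  0<h : 0ℚ ℚ.< h
  0<h = pos* 0<δ (p<q⇒0<q-p δ-small)

  0<1+h : 0ℚ ℚ.< 1ℚ ℚ.+ h
  0<1+h = ℚ.+-mono-< 0<1 0<h

  -- `h` is chosen so that the second-order terms cancel: the left side is exactly 1 - (2n - 1) δ,
  -- Bernoulli's lower bound for `X`.
  Y+h≤X : Y ℚ.+ h ℚ.≤ X
  Y+h≤X = begin
    Y ℚ.+ h
      ≡⟨ cong (λ z → 1ℚ ℚ.+ D ℚ.* D ℚ.* (δ ℚ.* δ) ℚ.- (z ℚ.* δ ℚ.+ z ℚ.* δ) ℚ.+ h) ι-n ⟩
    1ℚ ℚ.+ D ℚ.* D ℚ.* (δ ℚ.* δ) ℚ.- ((1ℚ ℚ.+ p) ℚ.* δ ℚ.+ (1ℚ ℚ.+ p) ℚ.* δ) ℚ.+ h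
      ≡⟨ cancel D p δ ⟩
    1ℚ ℚ.+ (1ℚ ℚ.+ p ℚ.+ p) ℚ.* ℚ.- δ
      ≡⟨ cong (λ z → 1ℚ ℚ.+ z ℚ.* ℚ.- δ) (trans (ι-+ order (pred order)) (cong (ℚ._+ p) ι-n)) ⟨
    1ℚ ℚ.+ ι (order ℕ.+ pred order) ℚ.* ℚ.- δ
      ≤⟨ bernoulli (order ℕ.+ pred order) (ℚ.<⇒≤ 0<q) ⟩
    X ∎
    where
    open ℚ.≤-Reasoning
    p = ι (pred order)
    ι-n : ι n ≡ 1ℚ ℚ.+ p
    ι-n = trans (cong ι (sym (ℕ.suc-pred order {{order≢0}}))) (ι-suc (pred order))
    cancel : ∀ D p δ →
      1ℚ ℚ.+ D ℚ.* D ℚ.* (δ ℚ.* δ) ℚ.- ((1ℚ ℚ.+ p) ℚ.* δ ℚ.+ (1ℚ ℚ.+ p) ℚ.* δ) ℚ.+ δ ℚ.* (1ℚ ℚ.- D ℚ.* D ℚ.* δ)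
      ≡ 1ℚ ℚ.+ (1ℚ ℚ.+ p ℚ.+ p) ℚ.* ℚ.- δ
    cancel = solve 3 (λ D p δ →
      con 1ℚ :+ D :* D :* (δ :* δ) :- ((con 1ℚ :+ p) :* δ :+ (con 1ℚ :+ p) :* δ) :+ δ :* (con 1ℚ :- D :* D :* δ)
      := con 1ℚ :+ (con 1ℚ :+ p :+ p) :* (:- δ)) refl
      where open +-*-Solver

  Y*[1+h]≤X : Y ℚ.* (1ℚ ℚ.+ h) ℚ.≤ X
  Y*[1+h]≤X = begin
    Y ℚ.* (1ℚ ℚ.+ h)       ≡⟨ ℚ.*-distribˡ-+ Y 1ℚ h ⟩
    Y ℚ.* 1ℚ ℚ.+ Y ℚ.* h   ≤⟨ ℚ.+-mono-≤ (ℚ.≤-reflexive (ℚ.*-identityʳ Y)) (*-monoʳ (ℚ.<⇒≤ 0<h) Y≤1) ⟩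
    Y ℚ.+ 1ℚ ℚ.* h         ≡⟨ cong (Y ℚ.+_) (ℚ.*-identityˡ h) ⟩
    Y ℚ.+ h                ≤⟨ Y+h≤X ⟩
    X                      ∎
    where
    open ℚ.≤-Reasoning
    Y≤1 : Y ℚ.≤ 1ℚ
    Y≤1 = ℚ.≤-trans (+-slack (ℚ.<⇒≤ 0<h) refl) (ℚ.≤-trans Y+h≤X (^-≤1 (order ℕ.+ pred order) 0<q q≤1))

  treeWeight : (Vertex G → ℕ) → EdgeSet G → ℚ
  treeWeight k T = q ^ (n ℕ.* weight T (endpointSum G k))

  τ : (Vertex G → ℕ) → ℚ
  τ k = listSum (treeWeight k) trees

  degree : Vertex G → EdgeSet G → ℕ
  degree v T = weight T (ends-at G v)

  -- This is `τ k` times the expected degree of `v` in a random spanning tree drawn with probability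
  -- proportional to `treeWeight k`.
  degreeSum : (Vertex G → ℕ) → Vertex G → ℚ
  degreeSum k v = listSum (λ T → ι (degree v T) ℚ.* treeWeight k T) trees

  0<treeWeight : ∀ k T → 0ℚ ℚ.< treeWeight k T
  0<treeWeight k T = 0<^ (n ℕ.* weight T (endpointSum G k)) 0<q

  -- The cheap tree for `k` alone contributes this much to the tree sum.
  X^≤τ : ∀ k → X ^ sum k ℚ.≤ τ k
  X^≤τ k with T , tree , light ← cheap k = begin
    X ^ sum k                                   ≡⟨ Exp.^-assocʳ q (order ℕ.+ pred order) (sum k) ⟩
    q ^ ((order ℕ.+ pred order) ℕ.* sum k)      ≤⟨ ^-antitone 0<q q≤1 light ⟩
    treeWeight k T
      ≤⟨ term≤listSum (ℚ.<⇒≤ ∘ 0<treeWeight k) (∈-filter⁺ (isSpanningTree? G) (∈-allSubsets T) tree) ⟩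
    τ k                                         ∎
    where open ℚ.≤-Reasoning

  0<τ : ∀ k → 0ℚ ℚ.< τ k
  0<τ k = ℚ.<-≤-trans (0<^ (sum k) (0<^ (order ℕ.+ pred order) 0<q)) (X^≤τ k)

  bump : (Vertex G → ℕ) → Vertex G → Vertex G → ℕ
  bump k v u = ⟦ does (u Fin.≟ v) ⟧ ℕ.+ k u

  sum-bump : ∀ k v → sum (bump k v) ≡ suc (sum k)
  sum-bump k v = trans (∑-distrib-+ {order} _ k) (cong (ℕ._+ sum k)
    (trans (sum-cong-≗ {order} (λ u → trans (cong ⟦_⟧ (≟-comm u v)) (sym (ℕ.*-identityʳ _)))) (sum-δ v (λ _ → 1))))

  weight-bump : ∀ k v T → weight T (endpointSum G (bump k v)) ≡ degree v T ℕ.+ weight T (endpointSum G k)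
  weight-bump k v T = trans
    (sum-cong-≗ {size} (λ e → cong (⟦ lookup T e ⟧ ℕ.*_)
      (interchange ⟦ does (source G e Fin.≟ v) ⟧ (k (source G e)) ⟦ does (target G e Fin.≟ v) ⟧ (k (target G e)))))
    (weight-+ T (ends-at G v) (endpointSum G k))
    where
    interchange : ∀ a b c d → a ℕ.+ b ℕ.+ (c ℕ.+ d) ≡ a ℕ.+ c ℕ.+ (b ℕ.+ d)
    interchange = solve-∀

  degree-≤ : ∀ v T → degree v T ℕ.≤ size ℕ.* 2
  degree-≤ v T = ℕ.≤-trans
    (sum-mono (λ e → ℕ.*-mono-≤ (⟦⟧≤1 (lookup T e)) (ℕ.+-mono-≤ (⟦⟧≤1 (does (source G e Fin.≟ v))) (⟦⟧≤1 (does (target G e Fin.≟ v))))))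
    (ℕ.≤-reflexive (sum-const size 2))

  -- The increment multiplies the weight of `T` by (1 - δ)^(n d), where d is the degree of `v` in
  -- `T`. Bounding the second-order term uniformly through `D` leaves an expression linear in d, so
  -- that summing over trees produces `degreeSum`.
  treeWeight-bump : ∀ k v T → treeWeight (bump k v) T ℚ.≤
    (1ℚ ℚ.+ D ℚ.* D ℚ.* (δ ℚ.* δ)) ℚ.* treeWeight k T ℚ.+
    ℚ.- (ι n ℚ.* δ) ℚ.* (ι (degree v T) ℚ.* treeWeight k T)
  treeWeight-bump k v T = begin
    q ^ (n ℕ.* weight T (endpointSum G (bump k v)))
      ≡⟨ cong (q ^_) (trans (cong (n ℕ.*_) (weight-bump k v T)) (ℕ.*-distribˡ-+ n d _)) ⟩
    q ^ (n ℕ.* d ℕ.+ n ℕ.* weight T (endpointSum G k))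
      ≡⟨ Exp.^-homo-* q (n ℕ.* d) _ ⟩
    q ^ (n ℕ.* d) ℚ.* w
      ≤⟨ *-monoʳ (ℚ.<⇒≤ (0<treeWeight k T)) (ℚ.≤-trans (bernoulli² (n ℕ.* d) 0≤δ (ℚ.<⇒≤ 0<q))
           (ℚ.+-monoʳ-≤ (1ℚ ℚ.- ι (n ℕ.* d) ℚ.* δ) (*-monoʳ (0≤* 0≤δ 0≤δ) square-≤))) ⟩
    (1ℚ ℚ.- ι (n ℕ.* d) ℚ.* δ ℚ.+ D ℚ.* D ℚ.* (δ ℚ.* δ)) ℚ.* w
      ≡⟨ cong (λ z → (1ℚ ℚ.- z ℚ.* δ ℚ.+ D ℚ.* D ℚ.* (δ ℚ.* δ)) ℚ.* w) (ι-* n d) ⟩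
    (1ℚ ℚ.- ι n ℚ.* ι d ℚ.* δ ℚ.+ D ℚ.* D ℚ.* (δ ℚ.* δ)) ℚ.* w
      ≡⟨ regroup (ι n) (ι d) δ (D ℚ.* D ℚ.* (δ ℚ.* δ)) w ⟩
    (1ℚ ℚ.+ D ℚ.* D ℚ.* (δ ℚ.* δ)) ℚ.* w ℚ.+ ℚ.- (ι n ℚ.* δ) ℚ.* (ι d ℚ.* w) ∎
    where
    open ℚ.≤-Reasoning
    d = degree v T
    w = treeWeight k T
    nd≤D : ι (n ℕ.* d) ℚ.≤ D
    nd≤D = ι-mono (ℕ.*-monoʳ-≤ n (degree-≤ v T))
    square-≤ : ι (n ℕ.* d) ℚ.* ι (n ℕ.* d) ℚ.≤ D ℚ.* D
    square-≤ = ℚ.≤-trans (*-monoˡ (0≤ι (n ℕ.* d)) nd≤D) (*-monoʳ (0≤ι (degreeBound G)) nd≤D)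
    regroup : ∀ n d δ e w → (1ℚ ℚ.- n ℚ.* d ℚ.* δ ℚ.+ e) ℚ.* w ≡ (1ℚ ℚ.+ e) ℚ.* w ℚ.+ ℚ.- (n ℚ.* δ) ℚ.* (d ℚ.* w)
    regroup = solve 5 (λ n d δ e w → (con 1ℚ :- n :* d :* δ :+ e) :* w :=
                                     (con 1ℚ :+ e) :* w :+ (:- (n :* δ)) :* (d :* w)) refl
      where open +-*-Solver

  -- Summing `treeWeight-bump` over all trees and using that the expected degree is at least 2
  -- bounds the new tree sum by `Y * τ k`.
  τ-bump : ∀ k v → τ k ℚ.+ τ k ℚ.≤ degreeSum k v → τ (bump k v) ℚ.* (1ℚ ℚ.+ h) ℚ.≤ X ℚ.* τ k
  τ-bump k v large = begin
    τ (bump k v) ℚ.* (1ℚ ℚ.+ h)       ≤⟨ *-monoʳ (ℚ.<⇒≤ 0<1+h) τ′≤Yτ ⟩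
    Y ℚ.* τ k ℚ.* (1ℚ ℚ.+ h)          ≡⟨ rotate Y (τ k) (1ℚ ℚ.+ h) ⟩
    Y ℚ.* (1ℚ ℚ.+ h) ℚ.* τ k          ≤⟨ *-monoʳ (ℚ.<⇒≤ (0<τ k)) Y*[1+h]≤X ⟩
    X ℚ.* τ k                         ∎
    where
    open ℚ.≤-Reasoning
    b = ι n ℚ.* δ
    c = 1ℚ ℚ.+ D ℚ.* D ℚ.* (δ ℚ.* δ)
    rotate : ∀ x y z → x ℚ.* y ℚ.* z ≡ x ℚ.* z ℚ.* y
    rotate = solve 3 (λ x y z → x :* y :* z := x :* z :* y) refl
      where open +-*-Solver
    absorb : ∀ c b t s → c ℚ.* t ℚ.+ ℚ.- b ℚ.* s ℚ.+ b ℚ.* (s ℚ.- (t ℚ.+ t)) ≡ (c ℚ.- (b ℚ.+ b)) ℚ.* t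
    absorb = solve 4 (λ c b t s → c :* t :+ (:- b) :* s :+ b :* (s :- (t :+ t)) := (c :- (b :+ b)) :* t) refl
      where open +-*-Solver
    0≤excess : 0ℚ ℚ.≤ degreeSum k v ℚ.- (τ k ℚ.+ τ k)
    0≤excess = subst (ℚ._≤ degreeSum k v ℚ.- (τ k ℚ.+ τ k)) (ℚ.+-inverseʳ (τ k ℚ.+ τ k)) (ℚ.+-monoˡ-≤ _ large)
    τ′≤Yτ : τ (bump k v) ℚ.≤ Y ℚ.* τ k
    τ′≤Yτ = begin
      τ (bump k v)
        ≤⟨ listSum-mono (treeWeight-bump k v) trees ⟩
      listSum (λ T → c ℚ.* treeWeight k T ℚ.+ ℚ.- b ℚ.* (ι (degree v T) ℚ.* treeWeight k T)) trees
        ≡⟨ listSum-linear c (ℚ.- b) _ _ trees ⟩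
      c ℚ.* τ k ℚ.+ ℚ.- b ℚ.* degreeSum k v
        ≤⟨ +-slack (0≤* (0≤* (0≤ι n) 0≤δ) 0≤excess) (absorb c b (τ k) (degreeSum k v)) ⟩
      Y ℚ.* τ k ∎

  Balanced : (Vertex G → ℕ) → Set
  Balanced k = ∀ v → degreeSum k v ℚ.< τ k ℚ.+ τ k

  τ₀ : ℚ
  τ₀ = τ (λ _ → 0)

  -- The invariant of the search: on average each increment so far has multiplied the tree sum by at
  -- most X / (1 + h).
  Decayed : (Vertex G → ℕ) → Set
  Decayed k = τ k ℚ.* (1ℚ ℚ.+ h) ^ sum k ℚ.≤ X ^ sum k ℚ.* τ₀

  decayed-bump : ∀ k v → Decayed k → τ k ℚ.+ τ k ℚ.≤ degreeSum k v → Decayed (bump k v)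
  decayed-bump k v dec large rewrite sum-bump k v = begin
    τ (bump k v) ℚ.* ((1ℚ ℚ.+ h) ℚ.* (1ℚ ℚ.+ h) ^ sum k)   ≡⟨ ℚ.*-assoc (τ (bump k v)) (1ℚ ℚ.+ h) _ ⟨
    τ (bump k v) ℚ.* (1ℚ ℚ.+ h) ℚ.* (1ℚ ℚ.+ h) ^ sum k     ≤⟨ *-monoʳ (ℚ.<⇒≤ (0<^ (sum k) 0<1+h)) (τ-bump k v large) ⟩
    X ℚ.* τ k ℚ.* (1ℚ ℚ.+ h) ^ sum k                       ≡⟨ ℚ.*-assoc X (τ k) _ ⟩
    X ℚ.* (τ k ℚ.* (1ℚ ℚ.+ h) ^ sum k)                     ≤⟨ *-monoˡ (ℚ.<⇒≤ (0<^ (order ℕ.+ pred order) 0<q)) dec ⟩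
    X ℚ.* (X ^ sum k ℚ.* τ₀)                               ≡⟨ ℚ.*-assoc X (X ^ sum k) τ₀ ⟨
    X ℚ.* X ^ sum k ℚ.* τ₀                                 ∎
    where open ℚ.≤-Reasoning

  -- Against the lower bound `X^≤τ` the powers of `X` cancel, leaving (1 + h)^(Σ k) ≤ `τ₀`.
  -- Bernoulli's inequality makes this a linear bound on the number of increments.
  decayed⇒bounded : ∀ k → Decayed k → 1ℚ ℚ.+ ι (sum k) ℚ.* h ℚ.≤ τ₀
  decayed⇒bounded k dec = ℚ.≤-trans (bernoulli (sum k) (ℚ.<⇒≤ 0<1+h))
    (ℚ.*-cancelˡ-≤-pos (X ^ sum k) {{ℚ.positive (0<^ (sum k) (0<^ (order ℕ.+ pred order) 0<q))}}
      (ℚ.≤-trans (*-monoʳ (ℚ.<⇒≤ (0<^ (sum k) 0<1+h)) (X^≤τ k)) dec))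

  -- The sum of `sum k` and `fuel` stays constant. Once the fuel is spent, `sum k * h` has reached
  -- `τ₀`, contradicting `decayed⇒bounded`.
  search : ∀ fuel k → Decayed k → τ₀ ℚ.≤ ι (sum k ℕ.+ fuel) ℚ.* h → ∃ Balanced
  search fuel k dec enough with Fin.all? (λ v → degreeSum k v ℚ.<? τ k ℚ.+ τ k)
  ... | yes balanced = k , balanced
  search zero k dec enough | no _ = contradiction (begin-strict
    ι (sum k) ℚ.* h                   ≡⟨ ℚ.+-identityˡ _ ⟨
    0ℚ ℚ.+ ι (sum k) ℚ.* h            <⟨ ℚ.+-monoˡ-< (ι (sum k) ℚ.* h) 0<1 ⟩
    1ℚ ℚ.+ ι (sum k) ℚ.* h            ≤⟨ decayed⇒bounded k dec ⟩
    τ₀                                ≤⟨ enough ⟩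
    ι (sum k ℕ.+ 0) ℚ.* h             ≡⟨ cong (λ m → ι m ℚ.* h) (ℕ.+-identityʳ (sum k)) ⟩
    ι (sum k) ℚ.* h                   ∎) (ℚ.<-irrefl refl)
    where open ℚ.≤-Reasoning
  search (suc fuel) k dec enough | no unbalanced
    with v , large ← Fin.¬∀⟶∃¬ order _ (λ v → degreeSum k v ℚ.<? τ k ℚ.+ τ k) unbalanced =
    search fuel (bump k v) (decayed-bump k v dec (ℚ.≮⇒≥ large))
      (subst (λ m → τ₀ ℚ.≤ ι m ℚ.* h) (trans (ℕ.+-suc (sum k) fuel) (cong (ℕ._+ fuel) (sym (sum-bump k v)))) enough)

  balanced : ∃ Balanced
  balanced =
    -- The fuel is an integer at least τ₀ / h.
    let t , 0<t , ht≡τ₀ = shrink h τ₀ 0<h (0<τ (λ _ → 0))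
        B , t≤B         = archimedean t
    in search B (λ _ → 0) initial
         (subst₂ ℚ._≤_ (trans (ℚ.*-comm t h) ht≡τ₀)
           (cong (λ m → ι (m ℕ.+ B) ℚ.* h) (sym (sum-replicate-zero order))) (*-monoʳ (ℚ.<⇒≤ 0<h) t≤B))
    where
    initial : Decayed (λ _ → 0)
    initial = subst (λ m → τ₀ ℚ.* (1ℚ ℚ.+ h) ^ m ℚ.≤ X ^ m ℚ.* τ₀) (sym (sum-replicate-zero order))
      (ℚ.≤-reflexive (ℚ.*-comm τ₀ 1ℚ))

  -- From a balanced potential to positive curvature.

  module Realize (k : Vertex G → ℕ) (bal : Balanced k) where

    -- The weights are constant sequences, so the curvature is one too, and its positivity is a
    -- statement about a single rational.
    c : Edge G → ℝ
    c e = fromℚ (q ^ (order ℕ.* endpointSum G k e))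

    seq-productOver : ∀ i T → seq (productOver T c) i ≡ treeWeight k T
    seq-productOver i T = trans (seq-product-^ q (lookup T) (λ e → order ℕ.* endpointSum G k e) i)
      (cong (q ^_) (weight-*ˡ T order (endpointSum G k)))

    seq-treeSum : ∀ i → seq (treeSum G c) i ≡ τ k
    seq-treeSum i = seq-weightSum {G} c (treeWeight k) i (seq-productOver i) trees

    0<treeSum : 0ℝ < treeSum G c
    0<treeSum = τ k , 0<τ k , 0 , λ {i} _ →
      ℚ.≤-reflexive (trans (ℚ.+-identityˡ (τ k)) (sym (seq-treeSum i)))

    r : ℚ
    r = recipℚ (τ k)

    S : Vertex G → ℚ
    S v = ℚ-weight (incident G v) (λ e → r ℚ.* listSum (treeWeight k) (filter (e ∈?_) trees))

    seq-curvature : ∀ v i → seq (curvature G c 0<treeSum v) i ≡ 1ℚ ℚ.- ½ ℚ.* S v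
    seq-curvature v i = cong (λ z → 1ℚ ℚ.- ½ ℚ.* z) (trans
      (seq-sumOver (incident G v) (relativeResistance G c 0<treeSum) i)
      (ℚΣ.sum-cong-≗ {size} λ e → cong (λ z → if lookup (incident G v) e then z else 0ℚ) (trans
        (cong₂ ℚ._*_ (seq-weightSum {G} c (treeWeight k) i (seq-productOver i) (filter (e ∈?_) trees))
                     (cong recipℚ (seq-treeSum i)))
        (ℚ.*-comm _ r))))

    -- Multiplying by `τ k` clears the reciprocal; double counting then bounds the left side by
    -- `degreeSum k v`, which balance keeps below twice `τ k`.
    S<2 : ∀ v → S v ℚ.< 1ℚ ℚ.+ 1ℚ
    S<2 v = ℚ.*-cancelˡ-<-nonNeg (τ k) {{ℚ.nonNegative (ℚ.<⇒≤ (0<τ k))}} (begin-strict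
      τ k ℚ.* S v                ≡⟨ cong (τ k ℚ.*_) (ℚ-weight-*ˡ (incident G v) r _) ⟩
      τ k ℚ.* (r ℚ.* B)          ≡⟨ ℚ.*-assoc (τ k) r B ⟨
      τ k ℚ.* r ℚ.* B            ≡⟨ cong (ℚ._* B) (recipℚ-inverse (τ k) (0<τ k)) ⟩
      1ℚ ℚ.* B                   ≡⟨ ℚ.*-identityˡ B ⟩
      B                          ≤⟨ incidentSum-≤ G v (treeWeight k) (ℚ.<⇒≤ ∘ 0<treeWeight k) trees ⟩
      degreeSum k v              <⟨ bal v ⟩
      τ k ℚ.+ τ k                ≡⟨ double (τ k) ⟩
      τ k ℚ.* (1ℚ ℚ.+ 1ℚ)        ∎)
      where
      open ℚ.≤-Reasoning
      B = ℚ-weight (incident G v) (λ e → listSum (treeWeight k) (filter (e ∈?_) trees))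
      double : ∀ t → t ℚ.+ t ≡ t ℚ.* (1ℚ ℚ.+ 1ℚ)
      double = solve 1 (λ t → t :+ t := t :* (con 1ℚ :+ con 1ℚ)) refl
        where open +-*-Solver

    positive : ResistancePositive G
    positive = c ,
      (λ e → q ^ (order ℕ.* endpointSum G k e) , 0<^ (order ℕ.* endpointSum G k e) 0<q , 0 ,
             λ _ → ℚ.≤-reflexive (ℚ.+-identityˡ _)) ,
      0<treeSum ,
      λ v → 1ℚ ℚ.- ½ ℚ.* S v ,
            p<q⇒0<q-p (ℚ.*-monoʳ-<-pos ½ (S<2 v)) , 0 ,
            λ {i} _ → ℚ.≤-reflexive (trans (ℚ.+-identityˡ _) (sym (seq-curvature v i)))

  resistancePositive : ResistancePositive G
  resistancePositive = Realize.positive (proj₁ balanced) (proj₂ balanced)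

-- The choice of constants and the conclusion.

cheapTrees⇒resistancePositive : ∀ G → NonZero (Graph.order G) → HasCheapTrees G → ResistancePositive G
cheapTrees⇒resistancePositive G order≢0 cheap =
  -- With δ = 1 / (D² + 2), the identity δ + δ + D² δ = 1 yields both δ < 1 and D² δ < 1.
  let δ , 0<δ , eq = shrink (ι (suc (suc (D ℕ.* D)))) 1ℚ (0<ι (suc (suc (D ℕ.* D)))) 0<1
  in Descent.resistancePositive G order≢0 cheap δ 0<δ (0<1-δ 0<δ eq) (small 0<δ eq)
  where
  D = degreeBound G

  total : ∀ {δ} → ι (suc (suc (D ℕ.* D))) ℚ.* δ ≡ 1ℚ → δ ℚ.+ δ ℚ.+ ι D ℚ.* ι D ℚ.* δ ≡ 1ℚ
  total {δ} eq = trans (trans (expand (ι D) δ) (cong (ℚ._* δ) (sym ι-D))) eq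
    where
    ι-D : ι (suc (suc (D ℕ.* D))) ≡ 1ℚ ℚ.+ (1ℚ ℚ.+ ι D ℚ.* ι D)
    ι-D = trans (ι-suc _) (cong (1ℚ ℚ.+_) (trans (ι-suc _) (cong (1ℚ ℚ.+_) (ι-* D D))))
    expand : ∀ d δ → δ ℚ.+ δ ℚ.+ d ℚ.* d ℚ.* δ ≡ (1ℚ ℚ.+ (1ℚ ℚ.+ d ℚ.* d)) ℚ.* δ
    expand = solve 2 (λ d δ → δ :+ δ :+ d :* d :* δ := (con 1ℚ :+ (con 1ℚ :+ d :* d)) :* δ) refl
      where open +-*-Solver

  0<1-δ : ∀ {δ} → 0ℚ ℚ.< δ → ι (suc (suc (D ℕ.* D))) ℚ.* δ ≡ 1ℚ → 0ℚ ℚ.< 1ℚ ℚ.- δ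
  0<1-δ {δ} 0<δ eq = subst (λ z → 0ℚ ℚ.< z ℚ.- δ) (total eq)
    (subst (0ℚ ℚ.<_) (drop δ (ι D ℚ.* ι D ℚ.* δ))
      (ℚ.+-mono-<-≤ 0<δ (0≤* (0≤* (0≤ι D) (0≤ι D)) (ℚ.<⇒≤ 0<δ))))
    where
    drop : ∀ δ e → δ ℚ.+ e ≡ δ ℚ.+ δ ℚ.+ e ℚ.- δ
    drop = solve 2 (λ δ e → δ :+ e := δ :+ δ :+ e :- δ) refl
      where open +-*-Solver

  small : ∀ {δ} → 0ℚ ℚ.< δ → ι (suc (suc (D ℕ.* D))) ℚ.* δ ≡ 1ℚ → ι D ℚ.* ι D ℚ.* δ ℚ.< 1ℚ
  small {δ} 0<δ eq = subst₂ ℚ._<_ (ℚ.+-identityˡ _) (total eq)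
    (ℚ.+-monoˡ-< (ι D ℚ.* ι D ℚ.* δ) (ℚ.+-mono-< 0<δ 0<δ))

theorem4 : (G : Graph) → Connected G → FractionallyHamiltonian G → ResistancePositive G
theorem4 G (order≢0 , _) (f , ham) =
  let g , cut , total = integral-approximation G f ham N
  in cheapTrees⇒resistancePositive G order≢0
       (Cuts.cheapSpanningTree G g N cut (suc size) total (ℕ.n≤1+n _))
  where
  open Graph G
  -- Large enough that the rounding error `s = suc size` meets the slack condition 2 (n - 1) s ≤ N;
  -- the added 1 keeps `N` nonzero even for a single vertex.
  N = suc (2 ℕ.* pred order ℕ.* suc size)
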